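{- Let $q=p^n$ where $p$ is a prime, let $\theta$ be a primitive element of $GF(q)$, and let $k\geq 4$ and $r\geq 1$ be integers with $q-1=kr$. Let $B:=\langle\theta^r\rangle\subseteq GF(q)$. Then the orbit of $B$ under the action of $PGL(2,q)$ on the $k$-subsets of $X=GF(q)\cup\{\infty\}$ is (the block set of) a simple $3$-$(q+1,k,\lambda)$ design on $X$, where $$\lambda=\begin{cases}(k-1)(k-2)/2 & \text{if } k-1 \text{ does not divide } q,\\ 1 & \text{if } k-1 \text{ divides } q.\end{cases}$$
   Context: $PGL(2,q)$ is the group of maps $x\mapsto \frac{ax+b}{cx+d}$ on $X=GF(q)\cup\{\infty\}$ with $a,b,c,d\in GF(q)$, $ad-bc\neq 0$, with the usual conventions for $\infty$. $\langle\theta^r\rangle$ denotes the multiplicative subgroup of $GF(q)^*$ generated by $\theta^r$ (of order $k$). A $3$-$(v,k,\lambda)$ design is a pair $(X,\mathcal{B})$ with $|X|=v$ and $\mathcal{B}$ a collection of $k$-subsets (blocks) of $X$ such that every $3$-subset of $X$ lies in exactly $\lambda$ blocks; it is simple if $\mathcal{B}$ has no repeated blocks. -}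

module Defs where

open import Data.Nat as ℕ using (ℕ; zero; suc; _∸_; _≤_)
open import Data.Nat.Divisibility using (_∣?_)
open import Data.Nat.DivMod using (_/_)
open import Data.Fin using (Fin; zero; suc)
open import Data.Fin.Subset using (Subset; _∈_)
open import Data.Product using (Σ; ∃; ∃-syntax; _×_; _,_)
open import Data.Bool using (if_then_else_)
open import Relation.Nullary using (¬_; does)
open import Relation.Binary.PropositionalEquality using (_≡_; _≢_)
open import Function.Bundles using (_⇔_)
open import Algebra.Structures using (IsCommutativeRing)
open import Data.Fin using (_≟_)

-- A field whose carrier is Fin q (hence a field with exactly q elements,
-- i.e. a model of GF(q)), with propositional equality.
record FiniteField (q : ℕ) : Set where
  infixl 7 _*_
  infixl 6 _+_ _-_
  field
    _+_ _*_ : Fin q → Fin q → Fin q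
    -_      : Fin q → Fin q
    0# 1#   : Fin q
    _⁻¹     : Fin q → Fin q
    isCommutativeRing : IsCommutativeRing _≡_ _+_ _*_ -_ 0# 1#
    0≢1     : 0# ≢ 1#
    ⁻¹-inverse : ∀ x → x ≢ 0# → x * (x ⁻¹) ≡ 1#

  _-_ : Fin q → Fin q → Fin q
  x - y = x + (- y)

  _/f_ : Fin q → Fin q → Fin q
  x /f y = x * (y ⁻¹)

  _^_ : Fin q → ℕ → Fin q
  x ^ zero  = 1#
  x ^ suc i = x * (x ^ i)

  Primitive : Fin q → Set
  Primitive θ = ∀ x → x ≢ 0# → ∃[ i ] (θ ^ i ≡ x)

  -- The projective line X = GF(q) ∪ {∞}, encoded as Fin (suc q):
  -- zero is ∞, and suc x is the field element x.
  X : Set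
  X = Fin (suc q)

  ∞ : X
  ∞ = zero

  möbius : Fin q → Fin q → Fin q → Fin q → X → X
  möbius a b c d zero =
    if does (c ≟ 0#) then ∞ else suc (a /f c)
  möbius a b c d (suc x) =
    if does ((c * x + d) ≟ 0#) then ∞ else suc ((a * x + b) /f (c * x + d))

  InB : Fin q → ℕ → X → Set
  InB θ r y = ∃[ x ] (y ≡ suc x × ∃[ i ] (x ≡ (θ ^ r) ^ i))

  InOrbit : Fin q → ℕ → Subset (suc q) → Set
  InOrbit θ r S =
    ∃[ a ] ∃[ b ] ∃[ c ] ∃[ d ] ((a * d - b * c ≢ 0#) ×
      (∀ y → (y ∈ S) ⇔ (∃[ x ] (InB θ r x × möbius a b c d x ≡ y))))

lam : ℕ → ℕ → ℕ
lam q k = if does ((k ∸ 1) ∣? q) then 1 else (((k ∸ 1) ℕ.* (k ∸ 2)) / 2)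

{-# OPTIONS --safe #-}

-- PGL(2,q) is sharply 3-transitive on X, so the blocks through a triple (t₁ , t₂ , t₃) correspond
-- to the injective triples of B up to the stabiliser of B.  Write β = θ^r.  A Möbius map preserves
-- B = { x | x^k = 1 } iff (ax + b)^k = (cx + d)^k on B, and reducing modulo X^k - 1 gives
-- C(k,i) (a^i b^(k-i) - c^i d^(k-i)) = 0 for 0 < i < k.
--
-- Let k - 1 = p^m u with p ∤ u.  If u > 1, the equations for i = 1 and i = p^m + 1, whose binomial
-- coefficients are prime to p, leave only the maps x ↦ s x and x ↦ s / x with s ∈ B.  Each triple
-- is then equivalent to (1 , β^i , β^j) for a unique pair 0 < i < j < k, because inversion replaces
-- (i , j) by (k - i , k - j); this gives λ = (k-1)(k-2)/2.
--
-- If u = 1, then x^(k-1) is both additive in x and inverse to x on B, so preserving B is a quadratic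
-- condition on x ∈ B: a Möbius map sending three points of B into B preserves B, and λ = 1.
module Submission where

open import Defs
open import Data.Product using (Σ; ∃; ∃₂; ∃-syntax; _×_; _,_; proj₁; proj₂)
open import Data.Sum using (_⊎_; inj₁; inj₂)
open import Data.Empty using (⊥; ⊥-elim)
open import Relation.Nullary using (¬_; Dec; yes; no; does; contradiction; ¬?)
open import Relation.Binary.PropositionalEquality using (_≡_; _≢_; refl; sym; trans; cong; cong₂; subst; subst₂; ≢-sym; module ≡-Reasoning)
open import Data.Nat using (ℕ; suc)

-- Divisibility of binomial coefficients by p shapes the proof: when p divides C(k,i), the equation
-- for i says nothing. Since k divides q - 1, p does not divide k, so i = 1 is always available, but
-- a b^(k-1) = c d^(k-1) alone does not force a zero entry. The index p^m + 1 is chosen because,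
-- combined with i = 1, every exponent except p^m cancels: if no entry is zero, (a d)^(p^m) = (b
-- c)^(p^m) remains, and x ↦ x^(p^m) is injective on F, so the determinant would vanish.
--
-- The split by u is the split of the statement: p^m ≤ k - 1 < q makes p^m a divisor of q, and u is
-- prime to p, so k - 1 divides q exactly when u = 1. In that case the index p^m + 1 is k itself and
-- its equation is lost. Geometrically, B is then projectively equivalent to the line over the
-- subfield of p^m elements, which accounts for its larger stabiliser.

module PrimePowers where

  -- Binomial coefficients modulo a prime

  open import Data.Nat
  open import Data.Nat.Properties
  open import Data.Nat.Divisibility
  open import Data.Nat.Primality
  open import Data.Nat.Combinatorics using (_C_; nC1≡n; nCk+nC[k+1]≡[n+1]C[k+1]; k>n⇒nCk≡0)
  open import Data.Nat.Coprimality using (Coprime; coprime-divisor)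
  open import Data.Nat.Induction using (<-rec)
  open import Data.Nat.Tactic.RingSolver using (solve-∀)

  [1+k]*[1+n]C[1+k]≡[1+n]*nCk : ∀ n k → suc k * (suc n C suc k) ≡ suc n * (n C k)
  [1+k]*[1+n]C[1+k]≡[1+n]*nCk zero    zero    = refl
  [1+k]*[1+n]C[1+k]≡[1+n]*nCk zero    (suc k) = begin
    suc (suc k) * (1 C suc (suc k)) ≡⟨ cong (suc (suc k) *_) (k>n⇒nCk≡0 {1} {suc (suc k)} (s≤s (s≤s z≤n))) ⟩
    suc (suc k) * 0                 ≡⟨ *-zeroʳ k ⟩
    0                               ≡⟨ k>n⇒nCk≡0 {0} {suc k} (s≤s z≤n) ⟨
    0 C suc k                       ≡⟨ *-identityˡ (0 C suc k) ⟨
    1 * (0 C suc k)                 ∎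
    where open ≡-Reasoning
  [1+k]*[1+n]C[1+k]≡[1+n]*nCk (suc n) zero    = begin
    1 * (suc (suc n) C 1)       ≡⟨ *-identityˡ _ ⟩
    suc (suc n) C 1             ≡⟨ nC1≡n (suc (suc n)) ⟩
    suc (suc n)                 ≡⟨ *-identityʳ (suc (suc n)) ⟨
    suc (suc n) * (suc n C 0)   ∎
    where open ≡-Reasoning
  [1+k]*[1+n]C[1+k]≡[1+n]*nCk (suc n) (suc k) = begin
    suc (suc k) * (suc (suc n) C suc (suc k))
      ≡⟨ cong (suc (suc k) *_) (nCk+nC[k+1]≡[n+1]C[k+1] (suc n) (suc k)) ⟨
    suc (suc k) * (a + b)
      ≡⟨ split (suc k) a b ⟩
    a + suc k * a + suc (suc k) * b
      ≡⟨ cong₂ (λ s t → a + s + t) ([1+k]*[1+n]C[1+k]≡[1+n]*nCk n k) ([1+k]*[1+n]C[1+k]≡[1+n]*nCk n (suc k)) ⟩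
    a + suc n * (n C k) + suc n * (n C suc k)
      ≡⟨ join a (suc n) (n C k) (n C suc k) ⟩
    a + suc n * (n C k + n C suc k)
      ≡⟨ cong (λ s → a + suc n * s) (nCk+nC[k+1]≡[n+1]C[k+1] n k) ⟩
    suc (suc n) * a ∎
    where
    open ≡-Reasoning
    a = suc n C suc k
    b = suc n C suc (suc k)
    split : ∀ k a b → suc k * (a + b) ≡ a + k * a + suc k * b
    split = solve-∀
    join : ∀ a n x y → a + n * x + n * y ≡ a + n * (x + y)
    join = solve-∀

  module _ {p} (pr : Prime p) where

    private instance
      p≢0 : NonZero p
      p≢0 = prime⇒nonZero pr

    p∤1 : ¬ p ∣ 1
    p∤1 p∣1 = contradiction (∣1⇒≡1 p∣1) λ { refl → ¬prime[1] pr }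

    p^m∣jc⇒p^m∣j : ∀ m {j c} → ¬ p ∣ c → p ^ m ∣ j * c → p ^ m ∣ j
    p^m∣jc⇒p^m∣j zero    {j} p∤c d = 1∣ j
    p^m∣jc⇒p^m∣j (suc m) {j} {c} p∤c d with euclidsLemma j c pr (∣-trans (m∣m*n (p ^ m)) d)
    ... | inj₂ p∣c = contradiction p∣c p∤c
    ... | inj₁ (divides j′ refl) =
      subst (p ^ suc m ∣_) (*-comm p j′)
        (*-monoʳ-∣ p (p^m∣jc⇒p^m∣j m p∤c
          (*-cancelˡ-∣ p (subst (p ^ suc m ∣_) (reorder j′ p c) d))))
      where
      reorder : ∀ j p c → j * p * c ≡ p * (j * c)
      reorder = solve-∀

    -- By absorption j C(N,j) = N C(N-1,j-1) is a multiple of p^m. If p did not divide C(N,j), then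
    -- p^m would divide j, which is too small.
    p∣NCj : ∀ m {N j} → p ^ m ∣ N → 0 < j → j < p ^ m → p ∣ N C j
    p∣NCj m {zero}  {j}     d 0<j j<p^m = subst (p ∣_) (sym (k>n⇒nCk≡0 0<j)) (p ∣0)
    p∣NCj m {suc N} {suc j} d 0<j j<p^m with p ∣? (suc N C suc j)
    ... | yes p∣C = p∣C
    ... | no  p∤C = contradiction (∣⇒≤ p^m∣j) (<⇒≱ j<p^m)
      where
      p^m∣j : p ^ m ∣ suc j
      p^m∣j = p^m∣jc⇒p^m∣j m p∤C
        (subst (p ^ m ∣_) (sym ([1+k]*[1+n]C[1+k]≡[1+n]*nCk N j)) (∣m⇒∣m*n (N C j) d))

    -- By Pascal's rule and `p∣NCj`, p divides C(N,j) + C(N,j+1), so divisibility of one coefficient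
    -- by p would descend to C(N,0) = 1.
    p∤[N-1]Cj : ∀ m {N} j → p ^ m ∣ suc N → j < p ^ m → ¬ p ∣ N C j
    p∤[N-1]Cj m     zero    d j<p^m p∣1 = p∤1 p∣1
    p∤[N-1]Cj m {N} (suc j) d j<p^m p∣C =
      p∤[N-1]Cj m j d (<-trans (n<1+n j) j<p^m)
        (∣m+n∣m⇒∣n (subst (p ∣_) (trans (sym (nCk+nC[k+1]≡[n+1]C[k+1] N j)) (+-comm (N C j) (N C suc j))) (p∣NCj m d (s≤s z≤n) j<p^m)) p∣C)

    -- Absorption at the index p^m cancels p^m and leaves u C(p^m u - 1 , p^m - 1), whose second
    -- factor is prime to p by `p∤[N-1]Cj`.
    p∤NCp^m : ∀ m u → ¬ p ∣ u → ¬ p ∣ (p ^ m * u) C (p ^ m)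
    p∤NCp^m m u p∤u = go (p ^ m) (p ^ m * u) refl refl
      where
      -- `Q` and `N` are variables so that they can be matched as successors, which `p ^ m` does not
      -- allow.
      go : ∀ Q N → Q ≡ p ^ m → N ≡ p ^ m * u → ¬ p ∣ N C Q
      go zero    N       Q≡ N≡ _ = m^n≢0⇒ Q≡
        where
        m^n≢0⇒ : ¬ 0 ≡ p ^ m
        m^n≢0⇒ = ≢-sym (≢-nonZero⁻¹ (p ^ m) {{m^n≢0 p m}})
      go (suc Q) zero    Q≡ N≡ _ with m*n≡0⇒m≡0∨n≡0 (p ^ m) (sym N≡)
      ... | inj₁ z = contradiction (trans Q≡ z) λ ()
      ... | inj₂ refl = p∤u (p ∣0)
      go (suc Q) (suc N) Q≡ N≡ p∣C with euclidsLemma u (N C Q) pr (subst (p ∣_) C≡ p∣C)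
        where
        C≡ : suc N C suc Q ≡ u * (N C Q)
        C≡ = *-cancelˡ-≡ _ _ (suc Q) (begin
          suc Q * (suc N C suc Q) ≡⟨ [1+k]*[1+n]C[1+k]≡[1+n]*nCk N Q ⟩
          suc N * (N C Q)         ≡⟨ cong (_* (N C Q)) (trans N≡ (cong (_* u) (sym Q≡))) ⟩
          suc Q * u * (N C Q)     ≡⟨ *-assoc (suc Q) u (N C Q) ⟩
          suc Q * (u * (N C Q))   ∎)
          where open ≡-Reasoning
      ... | inj₁ p∣u = p∤u p∣u
      ... | inj₂ p∣C′ = p∤[N-1]Cj m Q (subst (p ^ m ∣_) (sym N≡) (m∣m*n u)) (subst (Q <_) Q≡ (n<1+n Q)) p∣C′

    -- With k = 1 + p^m u, absorption gives (1 + p^m) C(k , 1 + p^m) = k C(k-1 , p^m), and p divides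
    -- neither factor on the right.
    p∤[1+N]C[1+p^m] : ∀ m u → ¬ p ∣ u → ¬ p ∣ suc (p ^ m * u) → ¬ p ∣ suc (p ^ m * u) C suc (p ^ m)
    p∤[1+N]C[1+p^m] m u p∤u p∤k p∣C
      with euclidsLemma (suc (p ^ m * u)) ((p ^ m * u) C (p ^ m)) pr
             (subst (p ∣_) ([1+k]*[1+n]C[1+k]≡[1+n]*nCk (p ^ m * u) (p ^ m)) (∣n⇒∣m*n (suc (p ^ m)) p∣C))
    ... | inj₁ p∣k = p∤k p∣k
    ... | inj₂ p∣C′ = p∤NCp^m m u p∤u p∣C′

    p-part : ∀ N → 0 < N → ∃₂ λ m u → N ≡ p ^ m * u × ¬ p ∣ u
    p-part = <-rec _ step
      where
      step : ∀ N → (∀ {M} → M < N → 0 < M → ∃₂ λ m u → M ≡ p ^ m * u × ¬ p ∣ u) →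
             0 < N → ∃₂ λ m u → N ≡ p ^ m * u × ¬ p ∣ u
      step N rec 0<N with p ∣? N
      ... | no p∤N = 0 , N , sym (*-identityˡ N) , p∤N
      ... | yes (divides (suc M) refl)
        with m , u , eq , p∤u ← rec {suc M} (m<m*n (suc M) p (nonTrivial⇒n>1 p {{prime⇒nonTrivial pr}})) (s≤s z≤n)
        = suc m , u , trans (cong (_* p) eq) (reorder (p ^ m) u p) , p∤u
        where
        reorder : ∀ x u p → x * u * p ≡ p * x * u
        reorder = solve-∀

    p∤u⇒coprime : ∀ {u} → ¬ p ∣ u → Coprime u p
    p∤u⇒coprime p∤u (d∣u , d∣p) with prime⇒irreducible pr d∣p
    ... | inj₁ d≡1 = d≡1
    ... | inj₂ refl = contradiction d∣u p∤u

    u∣p^n⇒u≡1 : ∀ n {u} → ¬ p ∣ u → u ∣ p ^ n → u ≡ 1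
    u∣p^n⇒u≡1 zero    p∤u d = ∣1⇒≡1 d
    u∣p^n⇒u≡1 (suc n) p∤u d = u∣p^n⇒u≡1 n p∤u (coprime-divisor (p∤u⇒coprime p∤u) d)

-- Counting with duplicate-free lists and finite subsets

module Enumeration where

  open import Data.Nat
  open import Data.Nat.Properties
  open import Data.Nat.DivMod using (m*n/n≡m)
  open import Data.Nat.Tactic.RingSolver using (solve-∀)
  open import Data.Fin using (Fin; zero; suc)
  import Data.Fin.Properties as Fin
  open import Data.Fin.Subset using (Subset; inside; outside; ∣_∣; _⊆_) renaming (_∈_ to _∈ˢ_)
  open import Data.Vec using ([]; _∷_; here; there; tabulate)
  open import Data.Vec.Properties using (lookup∘tabulate; []=⇒lookup; lookup⇒[]=)
  open import Relation.Unary using (Decidable)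
  open import Relation.Nullary.Decidable using (dec-true)
  open import Data.List using (List; []; _∷_; _++_; length; map; upTo)
  open import Data.List.Properties using (length-++; length-map; length-upTo)
  open import Data.List.Membership.Propositional using (_∈_)
  open import Data.List.Membership.Propositional.Properties
  open import Data.List.Membership.Propositional.Properties.WithK using (unique∧set⇒bag)
  open import Data.List.Relation.Binary.BagAndSetEquality using (∼bag⇒↭)
  open import Data.List.Relation.Binary.Permutation.Propositional.Properties using (↭-length)
  open import Data.List.Relation.Unary.Any using (here; there)
  open import Data.List.Relation.Unary.All as All using (All; []; _∷_)
  import Data.List.Relation.Unary.All.Properties as All
  open import Data.List.Relation.Unary.AllPairs using ([]; _∷_)
  open import Data.List.Relation.Unary.Unique.Propositional using (Unique)
  import Data.List.Relation.Unary.Unique.Propositional.Properties as Unique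
  open import Function.Bundles using (_⇔_; mk⇔; Equivalence)

  -- Without duplicates, equal membership makes the lists permutations of each other. The block size
  -- and λ are both counted this way.
  unique-sameLength : ∀ {A : Set} {xs ys : List A} → Unique xs → Unique ys →
                      (∀ {z} → z ∈ xs ⇔ z ∈ ys) → length xs ≡ length ys
  unique-sameLength uxs uys eq = ↭-length (∼bag⇒↭ (unique∧set⇒bag uxs uys eq))

  -- Injectivity is asked on the members of the list only: i ↦ β^i repeats beyond i < k, and the
  -- indexing of blocks by pairs has a default value.
  unique-map-on : ∀ {A B : Set} (f : A → B) {xs : List A} → Unique xs →
                  (∀ {x y} → x ∈ xs → y ∈ xs → f x ≡ f y → x ≡ y) → Unique (map f xs)
  unique-map-on f [] inj = []
  unique-map-on f (x∉xs ∷ u) inj =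
    All.map⁺ (All.tabulate λ y∈xs fx≡fy → All.lookup x∉xs y∈xs (inj (here refl) (there y∈xs) fx≡fy))
    ∷ unique-map-on f u (λ x∈ y∈ → inj (there x∈) (there y∈))

  elements : ∀ {n} → Subset n → List (Fin n)
  elements []            = []
  elements (inside  ∷ S) = zero ∷ map suc (elements S)
  elements (outside ∷ S) = map suc (elements S)

  length-elements : ∀ {n} (S : Subset n) → length (elements S) ≡ ∣ S ∣
  length-elements []            = refl
  length-elements (inside  ∷ S) = cong suc (trans (length-map suc (elements S)) (length-elements S))
  length-elements (outside ∷ S) = trans (length-map suc (elements S)) (length-elements S)

  elements-unique : ∀ {n} (S : Subset n) → Unique (elements S)
  elements-unique []            = []
  elements-unique (inside  ∷ S) =
    All.map⁺ (All.tabulate λ _ ()) ∷ Unique.map⁺ Fin.suc-injective (elements-unique S)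
  elements-unique (outside ∷ S) = Unique.map⁺ Fin.suc-injective (elements-unique S)

  ∈-elements⁺ : ∀ {n} {S : Subset n} {x} → x ∈ˢ S → x ∈ elements S
  ∈-elements⁺ {S = inside  ∷ S} here      = here refl
  ∈-elements⁺ {S = inside  ∷ S} (there p) = there (∈-map⁺ suc (∈-elements⁺ p))
  ∈-elements⁺ {S = outside ∷ S} (there p) = ∈-map⁺ suc (∈-elements⁺ p)

  ∈-elements⁻ : ∀ {n} {S : Subset n} {x} → x ∈ elements S → x ∈ˢ S
  ∈-elements⁻ {S = inside  ∷ S} (here refl) = here
  ∈-elements⁻ {S = inside  ∷ S} (there p) with _ , q , refl ← ∈-map⁻ suc p = there (∈-elements⁻ q)
  ∈-elements⁻ {S = outside ∷ S} p with _ , q , refl ← ∈-map⁻ suc p = there (∈-elements⁻ q)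

  ⊆⇒All : ∀ {n} {S S′ : Subset n} → S ⊆ S′ → All (_∈ˢ S′) (elements S)
  ⊆⇒All S⊆S′ = All.tabulate (λ x∈ → S⊆S′ (∈-elements⁻ x∈))

  All⇒⊆ : ∀ {n} {S S′ : Subset n} → All (_∈ˢ S′) (elements S) → S ⊆ S′
  All⇒⊆ all x∈ = All.lookup all (∈-elements⁺ x∈)

  ∣S∣≡length : ∀ {n} {S : Subset n} {xs} → Unique xs → (∀ {z} → z ∈ˢ S ⇔ z ∈ xs) → ∣ S ∣ ≡ length xs
  ∣S∣≡length {S = S} uxs eq = trans (sym (length-elements S))
    (unique-sameLength (elements-unique S) uxs
      (mk⇔ (λ p → Equivalence.to eq (∈-elements⁻ p)) (λ p → ∈-elements⁺ (Equivalence.from eq p))))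

  -- Opaque, since unfolding the tabulation makes comparing blocks very slow.
  opaque

    satisfying : ∀ {n} {P : Fin n → Set} → Decidable P → Subset n
    satisfying P? = tabulate λ x → does (P? x)

    ∈-satisfying⁺ : ∀ {n} {P : Fin n → Set} (P? : Decidable P) {x} → P x → x ∈ˢ satisfying P?
    ∈-satisfying⁺ P? {x} px = lookup⇒[]= x _ (trans (lookup∘tabulate (λ x → does (P? x)) x) (dec-true (P? x) px))

    ∈-satisfying⁻ : ∀ {n} {P : Fin n → Set} (P? : Decidable P) {x} → x ∈ˢ satisfying P? → P x
    ∈-satisfying⁻ P? {x} x∈ with P? x | trans (sym (lookup∘tabulate (λ x → does (P? x)) x)) ([]=⇒lookup x∈)
    ... | yes px | _ = px

  -- For n = k - 1, raising both entries by one gives the exponent pairs 0 < i < j < k.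
  pairs : ℕ → List (ℕ × ℕ)
  pairs zero    = []
  pairs (suc n) = map (_, n) (upTo n) ++ pairs n

  ∈-pairs⁺ : ∀ {n i j} → i < j → j < n → (i , j) ∈ pairs n
  ∈-pairs⁺ {suc n} {i} {j} i<j j<1+n with m<1+n⇒m<n∨m≡n j<1+n
  ... | inj₁ j<n  = ∈-++⁺ʳ (map (_, n) (upTo n)) (∈-pairs⁺ i<j j<n)
  ... | inj₂ refl = ∈-++⁺ˡ (∈-map⁺ (_, n) (∈-upTo⁺ i<j))

  ∈-pairs⁻ : ∀ n {i j} → (i , j) ∈ pairs n → i < j × j < n
  ∈-pairs⁻ (suc n) p with ∈-++⁻ (map (_, n) (upTo n)) p
  ... | inj₁ q with _ , i∈ , refl ← ∈-map⁻ (_, n) q = ∈-upTo⁻ i∈ , n<1+n n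
  ... | inj₂ q with i<j , j<n ← ∈-pairs⁻ n q = i<j , m<n⇒m<1+n j<n

  pairs-unique : ∀ n → Unique (pairs n)
  pairs-unique zero    = []
  pairs-unique (suc n) = Unique.++⁺ (Unique.map⁺ (cong proj₁) (Unique.upTo⁺ n)) (pairs-unique n)
    λ { (p , q) → disjoint p q }
    where
    disjoint : ∀ {z} → z ∈ map (_, n) (upTo n) → z ∈ pairs n → _
    disjoint p q with _ , _ , refl ← ∈-map⁻ (_, n) p = contradiction (proj₂ (∈-pairs⁻ n q)) (n≮n n)

  -- Doubling keeps truncated division out of the induction.
  length-pairs*2 : ∀ n → length (pairs (suc n)) * 2 ≡ suc n * n
  length-pairs*2 zero    = refl
  length-pairs*2 (suc n) = begin
    length (pairs (suc (suc n))) * 2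
      ≡⟨ cong (_* 2) (trans (length-++ (map (_, suc n) (upTo (suc n))))
           (cong (_+ length (pairs (suc n))) (trans (length-map (_, suc n) (upTo (suc n))) (length-upTo (suc n))))) ⟩
    (suc n + length (pairs (suc n))) * 2   ≡⟨ *-distribʳ-+ 2 (suc n) (length (pairs (suc n))) ⟩
    suc n * 2 + length (pairs (suc n)) * 2 ≡⟨ cong (suc n * 2 +_) (length-pairs*2 n) ⟩
    suc n * 2 + suc n * n                  ≡⟨ shuffle n ⟩
    suc (suc n) * suc n                    ∎
    where
    open ≡-Reasoning
    shuffle : ∀ n → suc n * 2 + suc n * n ≡ suc (suc n) * suc n
    shuffle = solve-∀

  length-pairs : ∀ n → length (pairs (suc n)) ≡ suc n * n / 2
  length-pairs n = trans (sym (m*n/n≡m _ 2)) (cong (_/ 2) (length-pairs*2 n))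

-- Field arithmetic, polynomials and characteristic

module FieldTheory {q} (F : FiniteField q) where

  open import Level using (0ℓ)
  open import Algebra.Bundles using (CommutativeRing)
  open import Data.Nat as ℕ using (ℕ; zero; suc; s≤s; z≤n)
  import Data.Nat.Properties as ℕ
  open import Data.Nat.Combinatorics using (_C_; nCn≡1)
  open import Data.Nat.Divisibility using (_∣_; divides; ∣-refl)
  open import Data.Nat.Primality using (Prime; prime⇒nonZero)
  open import Data.Nat.Coprimality using (coprime-Bézout)
  open import Data.Nat.GCD using (module Bézout)
  open import Data.Integer as ℤ using (ℤ; -[1+_]; _⊖_; _◃_) renaming (+_ to pos)
  import Data.Integer.Properties as ℤ
  import Data.Sign as Sign
  open import Data.Fin as Fin using (Fin; toℕ; _≟_)
  open import Data.Fin.Permutation using (permutation)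
  open import Data.Maybe using (Maybe; just; nothing)
  open import Function using (_∘_; id)
  open ≡-Reasoning
  open import Algebra.Solver.Ring.AlmostCommutativeRing using (fromCommutativeRing; _-Raw-AlmostCommutative⟶_)
  import Algebra.Solver.Ring
  open PrimePowers

  open FiniteField F public

  commutativeRing : CommutativeRing 0ℓ 0ℓ
  commutativeRing = record { isCommutativeRing = isCommutativeRing }

  open CommutativeRing commutativeRing public
    using (+-assoc; +-comm; +-identityˡ; +-identityʳ; *-assoc; *-comm; *-identityˡ; *-identityʳ;
           zeroˡ; zeroʳ; -‿inverseʳ; semiring; commutativeSemiring; ring)
  open import Algebra.Properties.Ring ring public
    using (-0#≈0#; -‿distribˡ-*; -‿distribʳ-*; -‿involutive; -‿+-comm; +-cancelˡ; x∙y⁻¹≈ε⇒x≈y)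

  open import Algebra.Properties.Semiring.Mult semiring public
    using (×-assocˡ; ×-assoc-*; ×1-homo-*; ×-homo-1) renaming (_×_ to _⋆_)
  import Algebra.Properties.Semiring.Mult.TCOptimised semiring as TC
  import Algebra.Properties.Semiring.Exp semiring as Exp
  import Algebra.Properties.CommutativeSemiring.Exp commutativeSemiring as CExp

  -- Integer coefficients compute, while the operations of the abstract field do not. The optimised
  -- multiple makes `con (pos 1)` denote `1#` definitionally.
  module Solver where

    ⟦_⟧ : ℤ → Fin q
    ⟦ pos n ⟧      = n TC.× 1#
    ⟦ -[1+ n ] ⟧ = - (suc n TC.× 1#)

    1+× : ∀ n → suc n TC.× 1# ≡ 1# + n TC.× 1#
    1+× n = TC.×-homo-+ 1# 1 n

    ⊖-homo : ∀ m n → ⟦ m ⊖ n ⟧ ≡ m TC.× 1# - n TC.× 1#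
    ⊖-homo zero    zero    = sym (-‿inverseʳ 0#)
    ⊖-homo zero    (suc n) = sym (+-identityˡ _)
    ⊖-homo (suc m) zero    = sym (trans (cong (suc m TC.× 1# +_) -0#≈0#) (+-identityʳ _))
    ⊖-homo (suc m) (suc n) = begin
      ⟦ suc m ⊖ suc n ⟧                 ≡⟨ cong ⟦_⟧ (ℤ.[1+m]⊖[1+n]≡m⊖n m n) ⟩
      ⟦ m ⊖ n ⟧                         ≡⟨ ⊖-homo m n ⟩
      a - b                             ≡⟨ cong (_- b) (+-identityˡ a) ⟨
      (0# + a) - b                      ≡⟨ cong (λ z → (z + a) - b) (-‿inverseʳ 1#) ⟨
      ((1# - 1#) + a) - b               ≡⟨ cong (_- b) (trans (+-assoc _ _ _) (cong (_+_ 1#) (+-comm _ _))) ⟩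
      (1# + (a + - 1#)) - b             ≡⟨ cong (_- b) (+-assoc _ _ _) ⟨
      ((1# + a) + - 1#) - b             ≡⟨ +-assoc _ _ _ ⟩
      (1# + a) + (- 1# + - b)           ≡⟨ cong ((1# + a) +_) (-‿+-comm 1# b) ⟩
      (1# + a) - (1# + b)               ≡⟨ cong₂ _-_ (1+× m) (1+× n) ⟨
      suc m TC.× 1# - suc n TC.× 1#     ∎
      where
      a = m TC.× 1#
      b = n TC.× 1#

    +-homo : ∀ i j → ⟦ i ℤ.+ j ⟧ ≡ ⟦ i ⟧ + ⟦ j ⟧
    +-homo (pos m)      (pos n)      = TC.×-homo-+ 1# m n
    +-homo (pos m)      (-[1+ n ]) = ⊖-homo m (suc n)
    +-homo (-[1+ m ]) (pos n)      = trans (⊖-homo n (suc m)) (+-comm _ _)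
    +-homo (-[1+ m ]) (-[1+ n ]) = begin
      - (suc (suc (m ℕ.+ n)) TC.× 1#)       ≡⟨ cong (λ z → - (z TC.× 1#)) (ℕ.+-suc (suc m) n) ⟨
      - ((suc m ℕ.+ suc n) TC.× 1#)         ≡⟨ cong -_ (TC.×-homo-+ 1# (suc m) (suc n)) ⟩
      - (suc m TC.× 1# + suc n TC.× 1#)     ≡⟨ -‿+-comm _ _ ⟨
      - (suc m TC.× 1#) - (suc n TC.× 1#)   ∎

    +◃-homo : ∀ n → ⟦ Sign.+ ◃ n ⟧ ≡ n TC.× 1#
    +◃-homo zero    = refl
    +◃-homo (suc n) = refl

    -◃-homo : ∀ n → ⟦ Sign.- ◃ n ⟧ ≡ - (n TC.× 1#)
    -◃-homo zero    = sym -0#≈0#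
    -◃-homo (suc n) = refl

    *-homo : ∀ i j → ⟦ i ℤ.* j ⟧ ≡ ⟦ i ⟧ * ⟦ j ⟧
    *-homo (pos m)      (pos n)      = trans (+◃-homo (m ℕ.* n)) (TC.×1-homo-* m n)
    *-homo (pos m)      (-[1+ n ]) = trans (-◃-homo (m ℕ.* suc n))
      (trans (cong -_ (TC.×1-homo-* m (suc n))) (-‿distribʳ-* _ _))
    *-homo (-[1+ m ]) (pos n)      = trans (-◃-homo (suc m ℕ.* n))
      (trans (cong -_ (TC.×1-homo-* (suc m) n)) (-‿distribˡ-* _ _))
    *-homo (-[1+ m ]) (-[1+ n ]) = begin
      (suc m ℕ.* suc n) TC.× 1#             ≡⟨ TC.×1-homo-* (suc m) (suc n) ⟩
      a * b                                 ≡⟨ -‿involutive _ ⟨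
      - (- (a * b))                         ≡⟨ cong -_ (-‿distribˡ-* a b) ⟩
      - (- a * b)                           ≡⟨ -‿distribʳ-* (- a) b ⟩
      - a * - b                             ∎
      where
      a = suc m TC.× 1#
      b = suc n TC.× 1#

    -‿homo : ∀ i → ⟦ ℤ.- i ⟧ ≡ - ⟦ i ⟧
    -‿homo (pos zero)   = sym -0#≈0#
    -‿homo (pos (suc n))  = refl
    -‿homo (-[1+ n ]) = sym (-‿involutive _)

    ℤ⟶F : CommutativeRing.rawRing ℤ.+-*-commutativeRing -Raw-AlmostCommutative⟶ fromCommutativeRing commutativeRing
    ℤ⟶F = record
      { ⟦_⟧    = ⟦_⟧
      ; +-homo = +-homo
      ; *-homo = *-homo
      ; -‿homo = -‿homo
      ; 0-homo = refl
      ; 1-homo = refl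
      }

    -- Distinct integers may have the same image in F, so only equality of integers gives an answer.
    weaklyDec : ∀ i j → Maybe (⟦ i ⟧ ≡ ⟦ j ⟧)
    weaklyDec i j with i ℤ.≟ j
    ... | yes i≡j = just (cong ⟦_⟧ i≡j)
    ... | no  _   = nothing

    open Algebra.Solver.Ring _ _ ℤ⟶F weaklyDec public using (solve; _:=_; _:+_; _:*_; _:-_; :-_; con)


  open Solver public using (solve; _:=_; _:+_; _:*_; _:-_; :-_; con)

  x-x≡0 : ∀ x → x - x ≡ 0#
  x-x≡0 = -‿inverseʳ

  x-y≡0⇒x≡y : ∀ {x y} → x - y ≡ 0# → x ≡ y
  x-y≡0⇒x≡y = x∙y⁻¹≈ε⇒x≈y _ _

  x≡y⇒x-y≡0 : ∀ {x y} → x ≡ y → x - y ≡ 0#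
  x≡y⇒x-y≡0 {x} refl = -‿inverseʳ x

  x*y≡0⇒y≡0 : ∀ {x y} → x ≢ 0# → x * y ≡ 0# → y ≡ 0#
  x*y≡0⇒y≡0 {x} {y} x≢0 xy≡0 = begin
    y                  ≡⟨ *-identityˡ y ⟨
    1# * y             ≡⟨ cong (_* y) (⁻¹-inverse x x≢0) ⟨
    x * (x ⁻¹) * y     ≡⟨ solve 3 (λ x i y → x :* i :* y := i :* (x :* y)) refl x (x ⁻¹) y ⟩
    (x ⁻¹) * (x * y)   ≡⟨ cong ((x ⁻¹) *_) xy≡0 ⟩
    (x ⁻¹) * 0#        ≡⟨ zeroʳ _ ⟩
    0#                 ∎

  *-≢0 : ∀ {x y} → x ≢ 0# → y ≢ 0# → x * y ≢ 0#
  *-≢0 x≢0 y≢0 xy≡0 = y≢0 (x*y≡0⇒y≡0 x≢0 xy≡0)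

  *-cancelˡ : ∀ {x y z} → x ≢ 0# → x * y ≡ x * z → y ≡ z
  *-cancelˡ {x} {y} {z} x≢0 eq = x-y≡0⇒x≡y (x*y≡0⇒y≡0 x≢0 (begin
    x * (y - z)      ≡⟨ solve 3 (λ x y z → x :* (y :- z) := x :* y :- x :* z) refl x y z ⟩
    x * y - x * z    ≡⟨ x≡y⇒x-y≡0 eq ⟩
    0#               ∎))

  1≢0 : 1# ≢ 0#
  1≢0 = ≢-sym 0≢1

  x*y≡1⇒x≢0 : ∀ {x y} → x * y ≡ 1# → x ≢ 0#
  x*y≡1⇒x≢0 {y = y} eq refl = 0≢1 (trans (sym (zeroˡ y)) eq)

  ^≡^ : ∀ x n → x ^ n ≡ x Exp.^ n
  ^≡^ x zero    = refl
  ^≡^ x (suc n) = cong (x *_) (^≡^ x n)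

  ^-+ : ∀ x m n → x ^ (m ℕ.+ n) ≡ x ^ m * x ^ n
  ^-+ x m n = trans (^≡^ x (m ℕ.+ n)) (trans (Exp.^-homo-* x m n) (sym (cong₂ _*_ (^≡^ x m) (^≡^ x n))))

  ^-* : ∀ x m n → x ^ (m ℕ.* n) ≡ (x ^ m) ^ n
  ^-* x m n = begin
    x ^ (m ℕ.* n)            ≡⟨ ^≡^ x (m ℕ.* n) ⟩
    x Exp.^ (m ℕ.* n)        ≡⟨ Exp.^-assocʳ x m n ⟨
    (x Exp.^ m) Exp.^ n      ≡⟨ ^≡^ (x Exp.^ m) n ⟨
    (x Exp.^ m) ^ n          ≡⟨ cong (_^ n) (^≡^ x m) ⟨
    (x ^ m) ^ n              ∎

  ^-distrib-* : ∀ x y n → (x * y) ^ n ≡ x ^ n * y ^ n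
  ^-distrib-* x y n = trans (^≡^ (x * y) n) (trans (CExp.^-distrib-* x y n) (sym (cong₂ _*_ (^≡^ x n) (^≡^ y n))))

  1^ : ∀ n → 1# ^ n ≡ 1#
  1^ zero    = refl
  1^ (suc n) = trans (*-identityˡ _) (1^ n)

  ^≢0 : ∀ {x} n → x ≢ 0# → x ^ n ≢ 0#
  ^≢0 zero    x≢0 = 1≢0
  ^≢0 (suc n) x≢0 = *-≢0 x≢0 (^≢0 n x≢0)

  ^-swap : ∀ x m n → (x ^ m) ^ n ≡ (x ^ n) ^ m
  ^-swap x m n = trans (sym (^-* x m n)) (trans (cong (x ^_) (ℕ.*-comm m n)) (^-* x n m))

  ^-≡1 : ∀ {x} m n → x ^ m ≡ 1# → x ^ (m ℕ.* n) ≡ 1#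
  ^-≡1 {x} m n eq = trans (^-* x m n) (trans (cong (_^ n) eq) (1^ n))

  ⋆1 : ∀ n x → n ⋆ x ≡ n ⋆ 1# * x
  ⋆1 n x = trans (cong (n ⋆_) (sym (*-identityˡ x))) (sym (×-assoc-* n 1# x))

  ⋆-zero : ∀ n → n ⋆ 0# ≡ 0#
  ⋆-zero n = trans (⋆1 n 0#) (zeroʳ _)

  -- Horner's scheme for a polynomial with n coefficients. They form a function on all of ℕ, so that
  -- dropping the constant term and dividing by X is `f ∘ suc`.
  eval : (ℕ → Fin q) → ℕ → Fin q → Fin q
  eval f zero    x = 0#
  eval f (suc n) x = f 0 + x * eval (f ∘ suc) n x

  eval-snoc : ∀ f n x → eval f (suc n) x ≡ eval f n x + f n * x ^ n
  eval-snoc f zero    x = solve 2 (λ f x → f :+ x :* con (pos 0) := con (pos 0) :+ f :* con (pos 1)) refl (f 0) x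
  eval-snoc f (suc n) x = begin
    f 0 + x * eval (f ∘ suc) (suc n) x
      ≡⟨ cong (λ z → f 0 + x * z) (eval-snoc (f ∘ suc) n x) ⟩
    f 0 + x * (eval (f ∘ suc) n x + f (suc n) * x ^ n)
      ≡⟨ solve 5 (λ a x e b y → a :+ x :* (e :+ b :* y) := a :+ x :* e :+ b :* (x :* y)) refl (f 0) x (eval (f ∘ suc) n x) (f (suc n)) (x ^ n) ⟩
    f 0 + x * eval (f ∘ suc) n x + f (suc n) * (x * x ^ n) ∎

  eval-zero : ∀ {f} n x → (∀ i → i ℕ.< n → f i ≡ 0#) → eval f n x ≡ 0#
  eval-zero zero    x eq = refl
  eval-zero (suc n) x eq = trans (cong₂ (λ a b → a + x * b) (eq 0 (s≤s z≤n)) (eval-zero n x (λ i i<n → eq (suc i) (s≤s i<n))))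
    (trans (+-identityˡ _) (zeroʳ x))

  eval-minus : ∀ f g n x → eval (λ i → f i - g i) n x ≡ eval f n x - eval g n x
  eval-minus f g zero    x = sym (-‿inverseʳ 0#)
  eval-minus f g (suc n) x = trans (cong (λ z → (f 0 - g 0) + x * z) (eval-minus (f ∘ suc) (g ∘ suc) n x))
    (solve 5 (λ a b x e h → a :- b :+ x :* (e :- h) := a :+ x :* e :- (b :+ x :* h)) refl
      (f 0) (g 0) x (eval (f ∘ suc) n x) (eval (g ∘ suc) n x))

  -- Coefficients of the quotient of X · f by X - r (synthetic division).
  quot : (ℕ → Fin q) → ℕ → Fin q → ℕ → Fin q
  quot f n r i = eval (λ j → f (i ℕ.+ j)) (n ℕ.∸ i) r

  -- When f is the tail of a polynomial g, the right-hand side is g(x) - g(r), so this is the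
  -- division of g by X - r.
  quot-spec : ∀ f n r x → (x - r) * eval (quot f n r) n x ≡ x * eval f n x - r * eval f n r
  quot-spec f zero    r x = solve 2 (λ x r → (x :- r) :* con (pos 0) := x :* con (pos 0) :- r :* con (pos 0)) refl x r
  quot-spec f (suc n) r x = begin
    (x - r) * (E + x * Q)
      ≡⟨ solve 4 (λ x r e q → (x :- r) :* (e :+ x :* q) := (x :- r) :* e :+ x :* ((x :- r) :* q)) refl x r E Q ⟩
    (x - r) * E + x * ((x - r) * Q)
      ≡⟨ cong (λ z → (x - r) * E + x * z) (quot-spec (f ∘ suc) n r x) ⟩
    (x - r) * (f 0 + r * er) + x * (x * ex - r * er)
      ≡⟨ solve 5 (λ x r f er ex → (x :- r) :* (f :+ r :* er) :+ x :* (x :* ex :- r :* er)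
                    := x :* (f :+ x :* ex) :- r :* (f :+ r :* er)) refl x r (f 0) er ex ⟩
    x * (f 0 + x * ex) - r * (f 0 + r * er) ∎
    where
    er = eval (f ∘ suc) n r
    ex = eval (f ∘ suc) n x
    E = f 0 + r * er
    Q = eval (quot (f ∘ suc) n r) n x

  -- Each coefficient of the quotient is `f i` plus r times the next one, so vanishing passes to f
  -- from the top coefficient downwards.
  quot-zero : ∀ f n r → (∀ i → i ℕ.< n → quot f n r i ≡ 0#) → ∀ i → i ℕ.< n → f i ≡ 0#
  quot-zero f (suc n) r z (suc i) (s≤s i<n) =
    quot-zero (f ∘ suc) n r (λ i i<n → z (suc i) (s≤s i<n)) i i<n
  quot-zero f (suc n) r z zero    _ = begin
    f 0                             ≡⟨ solve 2 (λ f r → f := f :+ r :* con (pos 0)) refl (f 0) r ⟩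
    f 0 + r * 0#                    ≡⟨ cong (λ y → f 0 + r * y) (eval-zero n r tail) ⟨
    f 0 + r * eval (f ∘ suc) n r      ≡⟨ z 0 (s≤s z≤n) ⟩
    0#                              ∎
    where
    tail : ∀ i → i ℕ.< n → f (suc i) ≡ 0#
    tail = quot-zero (f ∘ suc) n r (λ i i<n → z (suc i) (s≤s i<n))

  -- Division by X - ρ 0 leaves one coefficient and one root fewer. Once the quotient vanishes, so
  -- do the higher coefficients of f, and the root ρ 0 kills the constant term.
  n-roots⇒zero : ∀ f n (ρ : ℕ → Fin q) →
    (∀ {i j} → i ℕ.< j → j ℕ.< n → ρ i ≢ ρ j) →
    (∀ i → i ℕ.< n → eval f n (ρ i) ≡ 0#) →
    ∀ i → i ℕ.< n → f i ≡ 0#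
  n-roots⇒zero f (suc n) ρ distinct root = λ where
      zero    _         → f0≡0
      (suc i) (s≤s i<n) → tail i i<n
    where
    r = ρ 0
    root-quot : ∀ i → i ℕ.< n → eval (quot (f ∘ suc) n r) n (ρ (suc i)) ≡ 0#
    root-quot i i<n = x*y≡0⇒y≡0 (λ eq → distinct (s≤s z≤n) (s≤s i<n) (sym (x-y≡0⇒x≡y eq))) (begin
      (x - r) * eval (quot (f ∘ suc) n r) n x  ≡⟨ quot-spec (f ∘ suc) n r x ⟩
      x * ex - r * er                        ≡⟨ solve 3 (λ f a b → a :- b := f :+ a :- (f :+ b)) refl (f 0) (x * ex) (r * er) ⟩
      eval f (suc n) x - eval f (suc n) r        ≡⟨ cong₂ _-_ (root (suc i) (s≤s i<n)) (root 0 (s≤s z≤n)) ⟩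
      0# - 0#                                ≡⟨ x-x≡0 0# ⟩
      0#                                     ∎)
      where
      x = ρ (suc i)
      ex = eval (f ∘ suc) n x
      er = eval (f ∘ suc) n r
    tail : ∀ i → i ℕ.< n → f (suc i) ≡ 0#
    tail = quot-zero (f ∘ suc) n r
      (n-roots⇒zero (quot (f ∘ suc) n r) n (ρ ∘ suc) (λ i<j j<n → distinct (s≤s i<j) (s≤s j<n)) root-quot)
    f0≡0 : f 0 ≡ 0#
    f0≡0 = begin
      f 0                            ≡⟨ solve 2 (λ f r → f := f :+ r :* con (pos 0)) refl (f 0) r ⟩
      f 0 + r * 0#                   ≡⟨ cong (λ y → f 0 + r * y) (eval-zero n r tail) ⟨
      eval f (suc n) r                 ≡⟨ root 0 (s≤s z≤n) ⟩
      0#                             ∎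

  -- Binomial expansion and the Frobenius map

  open import Algebra.Properties.Semiring.Sum semiring
  import Algebra.Properties.CommutativeSemiring.Binomial commutativeSemiring as Binomial

  eval≡sum : ∀ f n x → eval f n x ≡ sum {n} (λ i → f (toℕ i) * x ^ toℕ i)
  eval≡sum f zero    x = refl
  eval≡sum f (suc n) x = cong₂ _+_ (sym (*-identityʳ (f 0))) (begin
    x * eval (f ∘ suc) n x
      ≡⟨ cong (x *_) (eval≡sum (f ∘ suc) n x) ⟩
    x * sum {n} (λ i → f (suc (toℕ i)) * x ^ toℕ i)
      ≡⟨ *-distribˡ-sum {n} x (λ i → f (suc (toℕ i)) * x ^ toℕ i) ⟩
    sum {n} (λ i → x * (f (suc (toℕ i)) * x ^ toℕ i))
      ≡⟨ sum-cong-≗ {n} (λ i → solve 3 (λ x f y → x :* (f :* y) := f :* (x :* y)) refl x (f (suc (toℕ i))) (x ^ toℕ i)) ⟩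
    sum {n} (λ i → f (suc (toℕ i)) * (x * x ^ toℕ i)) ∎)

  binom : Fin q → Fin q → ℕ → ℕ → Fin q
  binom a b n i = (n C i) ⋆ (a ^ i * b ^ (n ℕ.∸ i))

  binomial-eval : ∀ a b n x → (a * x + b) ^ n ≡ eval (binom a b n) (suc n) x
  binomial-eval a b n x = begin
    (a * x + b) ^ n                         ≡⟨ ^≡^ (a * x + b) n ⟩
    (a * x + b) Exp.^ n                     ≡⟨ Binomial.theorem n (a * x) b ⟩
    Binomial.binomialExpansion (a * x) b n  ≡⟨ sum-cong-≗ {suc n} (λ i → term (toℕ i)) ⟩
    sum {suc n} (λ i → binom a b n (toℕ i) * x ^ toℕ i)  ≡⟨ eval≡sum (binom a b n) (suc n) x ⟨
    eval (binom a b n) (suc n) x              ∎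
    where
    term : ∀ i → (n C i) ⋆ ((a * x) Exp.^ i * b Exp.^ (n ℕ.∸ i)) ≡ binom a b n i * x ^ i
    term i = trans (cong ((n C i) ⋆_) (begin
      (a * x) Exp.^ i * b Exp.^ (n ℕ.∸ i)  ≡⟨ cong₂ _*_ (^≡^ (a * x) i) (^≡^ b (n ℕ.∸ i)) ⟨
      (a * x) ^ i * b ^ (n ℕ.∸ i)          ≡⟨ cong (_* b ^ (n ℕ.∸ i)) (^-distrib-* a x i) ⟩
      a ^ i * x ^ i * b ^ (n ℕ.∸ i)        ≡⟨ solve 3 (λ a x b → a :* x :* b := a :* b :* x) refl (a ^ i) (x ^ i) (b ^ (n ℕ.∸ i)) ⟩
      a ^ i * b ^ (n ℕ.∸ i) * x ^ i        ∎)) (sym (×-assoc-* (n C i) _ _))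

  -- Translation by 1 permutes the field, so the sum of all elements equals itself plus q times 1.
  q⋆1≡0 : q ⋆ 1# ≡ 0#
  q⋆1≡0 = +-cancelˡ (sum {q} id) (q ⋆ 1#) 0# (begin
    sum {q} id + q ⋆ 1#                 ≡⟨ cong (sum {q} id +_) (sum-replicate q) ⟨
    sum {q} id + sum {q} (λ _ → 1#)     ≡⟨ ∑-distrib-+ {q} id (λ _ → 1#) ⟨
    sum {q} (λ i → i + 1#)              ≡⟨ sum-permute {q} {q} id π ⟨
    sum {q} id                          ≡⟨ +-identityʳ _ ⟨
    sum {q} id + 0#                     ∎)
    where
    π = permutation (_+ 1#) (_- 1#)
          (λ x → solve 1 (λ x → x :- con (pos 1) :+ con (pos 1) := x) refl x)
          (λ x → solve 1 (λ x → x :+ con (pos 1) :- con (pos 1) := x) refl x)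

  ^⋆1 : ∀ p n → (p ℕ.^ n) ⋆ 1# ≡ (p ⋆ 1#) ^ n
  ^⋆1 p zero    = +-identityʳ 1#
  ^⋆1 p (suc n) = trans (×1-homo-* p (p ℕ.^ n)) (cong (p ⋆ 1# *_) (^⋆1 p n))

  -- The n-th power of p times 1 is q times 1, hence 0, and a field has no nonzero nilpotent.
  p⋆1≡0 : ∀ p n → q ≡ p ℕ.^ n → p ⋆ 1# ≡ 0#
  p⋆1≡0 p n q≡p^n with p ⋆ 1# ≟ 0#
  ... | yes eq = eq
  ... | no neq = contradiction (trans (sym (^⋆1 p n)) (trans (cong (_⋆ 1#) (sym q≡p^n)) q⋆1≡0)) (^≢0 n neq)

  x*m⋆1≡0 : ∀ x m → m ⋆ 1# ≡ 0# → (x ℕ.* m) ⋆ 1# ≡ 0#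
  x*m⋆1≡0 x m eq = trans (sym (×-assocˡ 1# x m)) (trans (cong (x ⋆_) eq) (⋆-zero x))

  module Characteristic {p} (pr : Prime p) (p⋆1 : p ⋆ 1# ≡ 0#) where

    p∣m⇒m⋆x≡0 : ∀ {m} x → p ∣ m → m ⋆ x ≡ 0#
    p∣m⇒m⋆x≡0 x (divides c refl) = begin
      (c ℕ.* p) ⋆ x          ≡⟨ ×-assocˡ x c p ⟨
      c ⋆ (p ⋆ x)            ≡⟨ cong (c ⋆_) (trans (⋆1 p x) (trans (cong (_* x) p⋆1) (zeroˡ x))) ⟩
      c ⋆ 0#                 ≡⟨ ⋆-zero c ⟩
      0#                     ∎

    -- A Bézout relation between m and p would turn two vanishing multiples of 1 into 1 = 0. Its two
    -- cases differ in the sign.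
    p∤m⇒m⋆1≢0 : ∀ {m} → ¬ p ∣ m → m ⋆ 1# ≢ 0#
    p∤m⇒m⋆1≢0 {m} p∤m m⋆1≡0 with coprime-Bézout (p∤u⇒coprime pr p∤m)
    ... | Bézout.+- x y eq = contradiction (begin
        0#                          ≡⟨ x*m⋆1≡0 x m m⋆1≡0 ⟨
        (x ℕ.* m) ⋆ 1#              ≡⟨ cong (_⋆ 1#) eq ⟨
        (1 ℕ.+ y ℕ.* p) ⋆ 1#        ≡⟨ cong (1# +_) (x*m⋆1≡0 y p p⋆1) ⟩
        1# + 0#                     ≡⟨ +-identityʳ 1# ⟩
        1#                          ∎) 0≢1
    ... | Bézout.-+ x y eq = contradiction (begin
        0#                          ≡⟨ x*m⋆1≡0 y p p⋆1 ⟨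
        (y ℕ.* p) ⋆ 1#              ≡⟨ cong (_⋆ 1#) eq ⟨
        (1 ℕ.+ x ℕ.* m) ⋆ 1#        ≡⟨ cong (1# +_) (x*m⋆1≡0 x m m⋆1≡0) ⟩
        1# + 0#                     ≡⟨ +-identityʳ 1# ⟩
        1#                          ∎) 0≢1

    m⋆x≡0⇒x≡0 : ∀ {m x} → ¬ p ∣ m → m ⋆ x ≡ 0# → x ≡ 0#
    m⋆x≡0⇒x≡0 {m} {x} p∤m eq = x*y≡0⇒y≡0 (p∤m⇒m⋆1≢0 p∤m) (trans (sym (⋆1 m x)) eq)

    -- All binomial coefficients strictly between the two ends vanish in F by `p∣NCj`. The factor
    -- `1#` in the proof brings x + y into the linear form that `binomial-eval` expands.
    frobenius : ∀ m x y → (x + y) ^ (p ℕ.^ m) ≡ x ^ (p ℕ.^ m) + y ^ (p ℕ.^ m)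
    frobenius m x y = go (p ℕ.^ m) refl
      where
      go : ∀ Q → Q ≡ p ℕ.^ m → (x + y) ^ Q ≡ x ^ Q + y ^ Q
      go zero    Q≡ = contradiction (sym Q≡) (ℕ.≢-nonZero⁻¹ (p ℕ.^ m) {{ℕ.m^n≢0 p m {{prime⇒nonZero pr}}}})
      go (suc Q) Q≡ = begin
        (x + y) ^ suc Q                    ≡⟨ cong (λ z → (z + y) ^ suc Q) (*-identityˡ x) ⟨
        (1# * x + y) ^ suc Q               ≡⟨ binomial-eval 1# y (suc Q) x ⟩
        f 0 + x * eval (f ∘ suc) (suc Q) x   ≡⟨ cong (λ z → f 0 + x * z) (eval-snoc (f ∘ suc) Q x) ⟩
        f 0 + x * (eval (f ∘ suc) Q x + f (suc Q) * x ^ Q)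
          ≡⟨ cong₂ (λ a b → a + x * (b + f (suc Q) * x ^ Q)) f0 (eval-zero Q x middle) ⟩
        y ^ suc Q + x * (0# + f (suc Q) * x ^ Q)
          ≡⟨ cong (λ z → y ^ suc Q + x * (0# + z * x ^ Q)) fQ ⟩
        y ^ suc Q + x * (0# + 1# * x ^ Q)
          ≡⟨ solve 3 (λ y x z → y :+ x :* (con (pos 0) :+ con (pos 1) :* z) := x :* z :+ y) refl (y ^ suc Q) x (x ^ Q) ⟩
        x ^ suc Q + y ^ suc Q              ∎
        where
        f = binom 1# y (suc Q)
        f0 : f 0 ≡ y ^ suc Q
        f0 = trans (×-homo-1 _) (*-identityˡ _)
        fQ : f (suc Q) ≡ 1#
        fQ = begin
          (suc Q C suc Q) ⋆ (1# ^ suc Q * y ^ (Q ℕ.∸ Q))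
            ≡⟨ cong₂ (λ c e → c ⋆ (1# ^ suc Q * y ^ e)) (nCn≡1 (suc Q)) (ℕ.n∸n≡0 Q) ⟩
          1 ⋆ (1# ^ suc Q * 1#)     ≡⟨ ×-homo-1 _ ⟩
          1# ^ suc Q * 1#           ≡⟨ *-identityʳ _ ⟩
          1# ^ suc Q                ≡⟨ 1^ (suc Q) ⟩
          1#                        ∎
        middle : ∀ i → i ℕ.< Q → f (suc i) ≡ 0#
        middle i i<Q = p∣m⇒m⋆x≡0 _
          (p∣NCj pr m (subst (p ℕ.^ m ∣_) (sym Q≡) ∣-refl) (s≤s z≤n) (subst (suc i ℕ.<_) Q≡ (s≤s i<Q)))

-- The order of θ and the subgroup B

module PrimitiveElements {q′ : ℕ} (F : FiniteField (suc q′)) where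

  open import Data.Nat as ℕ using (zero; s≤s; z≤n; NonZero)
  import Data.Nat.Properties as ℕ
  open import Data.Nat.DivMod using (_%_; _/_; m≡m%n+[m/n]*n; m%n<n)
  open import Data.Nat.Divisibility using (_∣_; divides; m%n≡0⇒n∣m; *-cancelˡ-∣)
  open import Data.Fin as Fin using (Fin; toℕ; fromℕ<; punchIn; punchOut; _≟_)
  import Data.Fin.Properties as Fin
  open import Relation.Binary.Definitions using (tri<; tri≈; tri>)
  open ≡-Reasoning
  open FieldTheory F

  ^-% : ∀ {x e} .{{_ : NonZero e}} → x ^ e ≡ 1# → ∀ i → x ^ i ≡ x ^ (i % e)
  ^-% {x} {e} x^e≡1 i = begin
    x ^ i                                    ≡⟨ cong (x ^_) (m≡m%n+[m/n]*n i e) ⟩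
    x ^ (i % e ℕ.+ i / e ℕ.* e)              ≡⟨ ^-+ x (i % e) (i / e ℕ.* e) ⟩
    x ^ (i % e) * x ^ (i / e ℕ.* e)          ≡⟨ cong (λ z → x ^ (i % e) * x ^ z) (ℕ.*-comm (i / e) e) ⟩
    x ^ (i % e) * x ^ (e ℕ.* (i / e))        ≡⟨ cong (x ^ (i % e) *_) (^-≡1 e (i / e) x^e≡1) ⟩
    x ^ (i % e) * 1#                         ≡⟨ *-identityʳ _ ⟩
    x ^ (i % e)                              ∎

  module PrimitiveElement (θ : Fin (suc q′)) (generates : Primitive θ) (1<q′ : 1 ℕ.< q′) where

    nonzero : Fin q′ → Fin (suc q′)
    nonzero = punchIn 0#

    log : Fin q′ → ℕ
    log j = proj₁ (generates (nonzero j) (Fin.punchInᵢ≢i 0# j))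

    θ^log : ∀ j → θ ^ log j ≡ nonzero j
    θ^log j = proj₂ (generates (nonzero j) (Fin.punchInᵢ≢i 0# j))

    -- Pigeonhole on the q - 1 nonzero elements: labels that determine a power of θ must be at least
    -- q - 1 in number.
    q′≤codes : ∀ {e} (code : Fin q′ → Fin e) →
               (∀ i j → code i ≡ code j → θ ^ log i ≡ θ ^ log j) → q′ ℕ.≤ e
    q′≤codes code inj = Fin.injective⇒≤ {f = code} λ {i} {j} eq →
      Fin.punchIn-injective 0# i j (trans (sym (θ^log i)) (trans (inj i j eq) (θ^log j)))

    -- Otherwise θ^0 = 1 would be the only nonzero power, and a single label would do.
    θ≢0 : θ ≢ 0#
    θ≢0 θ≡0 = contradiction (q′≤codes {1} (λ _ → Fin.zero) (λ i j _ → trans (one i) (sym (one j)))) (ℕ.<⇒≱ 1<q′)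
      where
      one : ∀ j → θ ^ log j ≡ 1#
      one j with log j in eq
      ... | zero  = refl
      ... | suc e = contradiction
        (trans (sym (θ^log j)) (trans (cong (θ ^_) eq) (trans (cong (_* θ ^ e) θ≡0) (zeroˡ _))))
        (Fin.punchInᵢ≢i 0# j)

    -- The exponent modulo e serves as a label with e values.
    θ^e≡1⇒q′≤e : ∀ e → 0 ℕ.< e → θ ^ e ≡ 1# → q′ ℕ.≤ e
    θ^e≡1⇒q′≤e e@(suc _) _ θ^e≡1 = q′≤codes (λ j → fromℕ< (m%n<n (log j) e)) λ i j eq → begin
      θ ^ log i         ≡⟨ ^-% θ^e≡1 (log i) ⟩
      θ ^ (log i % e)   ≡⟨ cong (θ ^_) (Fin.fromℕ<-injective _ _ _ _ eq) ⟩
      θ ^ (log j % e)   ≡⟨ ^-% θ^e≡1 (log j) ⟨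
      θ ^ log j         ∎

    θ^i≡θ^j⇒θ^[j∸i]≡1 : ∀ {i j} → i ℕ.< j → θ ^ i ≡ θ ^ j → θ ^ (j ℕ.∸ i) ≡ 1#
    θ^i≡θ^j⇒θ^[j∸i]≡1 {i} {j} i<j eq = *-cancelˡ (^≢0 i θ≢0) (begin
      θ ^ i * θ ^ (j ℕ.∸ i)   ≡⟨ ^-+ θ i (j ℕ.∸ i) ⟨
      θ ^ (i ℕ.+ (j ℕ.∸ i))   ≡⟨ cong (θ ^_) (ℕ.m+[n∸m]≡n (ℕ.<⇒≤ i<j)) ⟩
      θ ^ j                   ≡⟨ eq ⟨
      θ ^ i                   ≡⟨ *-identityʳ _ ⟨
      θ ^ i * 1#              ∎)

    -- Two of the q powers θ^0 , ... , θ^(q-1) coincide, since only q - 1 elements are nonzero.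
    -- Their exponents differ by at most q - 1, and by at least q - 1 because of `θ^e≡1⇒q′≤e`.
    θ^q′≡1 : θ ^ q′ ≡ 1#
    θ^q′≡1
      with i , j , i<j , eq ← Fin.pigeonhole (ℕ.n<1+n q′)
             (λ i → punchOut {i = 0#} {j = θ ^ toℕ i} (≢-sym (^≢0 (toℕ i) θ≢0)))
      = subst (λ e → θ ^ e ≡ 1#) (ℕ.≤-antisym d≤q′ (θ^e≡1⇒q′≤e (toℕ j ℕ.∸ toℕ i) (ℕ.m<n⇒0<n∸m i<j) one)) one
      where
      one : θ ^ (toℕ j ℕ.∸ toℕ i) ≡ 1#
      one = θ^i≡θ^j⇒θ^[j∸i]≡1 i<j (Fin.punchOut-injective (≢-sym (^≢0 (toℕ i) θ≢0)) (≢-sym (^≢0 (toℕ j) θ≢0)) eq)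
      d≤q′ : toℕ j ℕ.∸ toℕ i ℕ.≤ q′
      d≤q′ = ℕ.≤-trans (ℕ.m∸n≤m (toℕ j) (toℕ i)) (ℕ.≤-pred (Fin.toℕ<n j))

    private instance
      q′≢0 : NonZero q′
      q′≢0 = ℕ.>-nonZero (ℕ.<-trans (s≤s z≤n) 1<q′)

    θ^e≡1⇒q′∣e : ∀ e → θ ^ e ≡ 1# → q′ ∣ e
    θ^e≡1⇒q′∣e e eq with e % q′ in rem
    ... | zero  = m%n≡0⇒n∣m e q′ rem
    ... | suc d = contradiction
        (θ^e≡1⇒q′≤e (suc d) (s≤s z≤n) (trans (cong (θ ^_) (sym rem)) (trans (sym (^-% θ^q′≡1 e)) eq)))
        (ℕ.<⇒≱ (subst (ℕ._< q′) rem (m%n<n e q′)))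

    θ^-distinct : ∀ {i j} → i ℕ.< j → j ℕ.< q′ → θ ^ i ≢ θ ^ j
    θ^-distinct {i} {j} i<j j<q′ eq = contradiction
      (θ^e≡1⇒q′≤e (j ℕ.∸ i) (ℕ.m<n⇒0<n∸m i<j) (θ^i≡θ^j⇒θ^[j∸i]≡1 i<j eq))
      (ℕ.<⇒≱ (ℕ.≤-<-trans (ℕ.m∸n≤m j i) j<q′))

    x^q≡x : ∀ x → x ^ suc q′ ≡ x
    x^q≡x x with x ≟ 0#
    ... | yes refl = zeroˡ _
    ... | no x≢0 with i , refl ← generates x x≢0 = begin
      θ ^ i * (θ ^ i) ^ q′   ≡⟨ cong (θ ^ i *_) (^-swap θ i q′) ⟩
      θ ^ i * (θ ^ q′) ^ i   ≡⟨ cong (λ z → θ ^ i * z ^ i) θ^q′≡1 ⟩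
      θ ^ i * 1# ^ i         ≡⟨ cong (θ ^ i *_) (1^ i) ⟩
      θ ^ i * 1#             ≡⟨ *-identityʳ _ ⟩
      θ ^ i                  ∎

    module Subgroup {k r : ℕ} (q′≡kr : q′ ≡ k ℕ.* r) where

      private instance
        k≢0 : NonZero k
        k≢0 = ℕ.m*n≢0⇒m≢0 k {r} {{subst NonZero q′≡kr q′≢0}}
        r≢0 : NonZero r
        r≢0 = ℕ.m*n≢0⇒n≢0 k {r} {{subst NonZero q′≡kr q′≢0}}

      β : Fin (suc q′)
      β = θ ^ r

      β^k≡1 : β ^ k ≡ 1#
      β^k≡1 = begin
        (θ ^ r) ^ k       ≡⟨ ^-* θ r k ⟨
        θ ^ (r ℕ.* k)     ≡⟨ cong (θ ^_) (trans (ℕ.*-comm r k) (sym q′≡kr)) ⟩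
        θ ^ q′            ≡⟨ θ^q′≡1 ⟩
        1#                ∎

      [β^i]^k≡1 : ∀ i → (β ^ i) ^ k ≡ 1#
      [β^i]^k≡1 i = trans (^-swap β i k) (trans (cong (_^ i) β^k≡1) (1^ i))

      β^-distinct : ∀ {i j} → i ℕ.< j → j ℕ.< k → β ^ i ≢ β ^ j
      β^-distinct {i} {j} i<j j<k eq =
        θ^-distinct (ℕ.*-monoʳ-< r i<j) (subst (r ℕ.* j ℕ.<_) (trans (ℕ.*-comm r k) (sym q′≡kr)) (ℕ.*-monoʳ-< r j<k))
          (trans (^-* θ r i) (trans eq (sym (^-* θ r j))))

      β^-injective : ∀ {i j} → i ℕ.< k → j ℕ.< k → β ^ i ≡ β ^ j → i ≡ j
      β^-injective {i} {j} i<k j<k eq with ℕ.<-cmp i j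
      ... | tri< i<j _ _ = contradiction eq (β^-distinct i<j j<k)
      ... | tri≈ _ i≡j _ = i≡j
      ... | tri> _ _ j<i = contradiction (sym eq) (β^-distinct j<i i<k)

      x^k≡1⇒x≢0 : ∀ {x} → x ^ k ≡ 1# → x ≢ 0#
      x^k≡1⇒x≢0 {x} eq refl = 0≢1 (trans (sym (0^ k)) eq)
        where
        0^ : ∀ n .{{_ : NonZero n}} → 0# ^ n ≡ 0#
        0^ (suc n) = zeroˡ _

      -- If x = θ^j, the order k r of θ divides j k, so r divides j.
      x^k≡1⇒x≡β^i : ∀ {x} → x ^ k ≡ 1# → ∃[ i ] (i ℕ.< k × x ≡ β ^ i)
      x^k≡1⇒x≡β^i {x} x^k≡1
        with j , refl ← generates x (x^k≡1⇒x≢0 x^k≡1)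
        with divides c refl ← *-cancelˡ-∣ {m = r} {n = j} k (subst₂ _∣_ q′≡kr (ℕ.*-comm j k) (θ^e≡1⇒q′∣e (j ℕ.* k) (trans (^-* θ j k) x^k≡1)))
        = c % k , m%n<n c k , (begin
          θ ^ (c ℕ.* r)                             ≡⟨ cong (θ ^_) (ℕ.*-comm c r) ⟩
          θ ^ (r ℕ.* c)                             ≡⟨ ^-* θ r c ⟩
          β ^ c                                     ≡⟨ ^-% β^k≡1 c ⟩
          β ^ (c % k)                               ∎)

-- The projective line and sharp 3-transitivity

module ProjectiveLine {q} (F : FiniteField q) where

  open import Data.Integer using () renaming (+_ to pos)
  open import Data.Bool using (if_then_else_)
  open import Data.Fin using (Fin; zero; suc; _≟_)
  open ≡-Reasoning
  open FieldTheory F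

  -- Homogeneous coordinates of a point: ∞ = (1 : 0) and x = (x : 1).
  hx hy : X → Fin q
  hx zero    = 1#
  hx (suc x) = x
  hy zero    = 0#
  hy (suc x) = 1#

  point : Fin q → Fin q → X
  point u v = if does (v ≟ 0#) then ∞ else suc (u /f v)

  point-unique : ∀ {u v l} P → l ≢ 0# → u ≡ l * hx P → v ≡ l * hy P → point u v ≡ P
  point-unique {v = v} {l} zero l≢0 u≡ v≡ with v ≟ 0#
  ... | yes _  = refl
  ... | no v≢0 = contradiction (trans v≡ (zeroʳ l)) v≢0
  point-unique {u} {v} {l} (suc x) l≢0 u≡ v≡ with v ≟ 0#
  ... | yes v≡0 = contradiction (trans (sym (*-identityʳ l)) (trans (sym v≡) v≡0)) l≢0
  ... | no v≢0  = cong suc (*-cancelˡ v≢0 (begin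
    v * (u * v ⁻¹)     ≡⟨ solve 3 (λ u v i → v :* (u :* i) := u :* (v :* i)) refl u v (v ⁻¹) ⟩
    u * (v * v ⁻¹)     ≡⟨ cong (u *_) (⁻¹-inverse v v≢0) ⟩
    u * 1#             ≡⟨ *-identityʳ u ⟩
    u                  ≡⟨ u≡ ⟩
    l * x              ≡⟨ cong (_* x) (trans (sym (*-identityʳ l)) (sym v≡)) ⟩
    v * x              ∎))

  point-scalar : ∀ {u v} → ¬ (u ≡ 0# × v ≡ 0#) →
    ∃ λ l → l ≢ 0# × u ≡ l * hx (point u v) × v ≡ l * hy (point u v)
  point-scalar {u} {v} uv≢0 with v ≟ 0#
  ... | yes v≡0 = u , (λ u≡0 → uv≢0 (u≡0 , v≡0)) , sym (*-identityʳ u) , trans v≡0 (sym (zeroʳ u))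
  ... | no v≢0  = v , v≢0 , sym (begin
      v * (u * v ⁻¹)     ≡⟨ solve 3 (λ u v i → v :* (u :* i) := u :* (v :* i)) refl u v (v ⁻¹) ⟩
      u * (v * v ⁻¹)     ≡⟨ cong (u *_) (⁻¹-inverse v v≢0) ⟩
      u * 1#             ≡⟨ *-identityʳ u ⟩
      u                  ∎) , sym (*-identityʳ v)

  record Mat : Set where
    constructor mat
    field a b c d : Fin q

  det : Mat → Fin q
  det (mat a b c d) = a * d - b * c

  infixl 7 _⊗_
  _⊗_ : Mat → Mat → Mat
  mat a b c d ⊗ mat a′ b′ c′ d′ =
    mat (a * a′ + b * c′) (a * b′ + b * d′) (c * a′ + d * c′) (c * b′ + d * d′)

  adj : Mat → Mat
  adj (mat a b c d) = mat d (- b) (- c) a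

  opaque

    det-⊗ : ∀ M N → det (M ⊗ N) ≡ det M * det N
    det-⊗ (mat a b c d) (mat a′ b′ c′ d′) = solve 8 (λ a b c d a′ b′ c′ d′ →
      (a :* a′ :+ b :* c′) :* (c :* b′ :+ d :* d′) :- (a :* b′ :+ b :* d′) :* (c :* a′ :+ d :* c′)
        := (a :* d :- b :* c) :* (a′ :* d′ :- b′ :* c′)) refl a b c d a′ b′ c′ d′

    det-adj : ∀ M → det (adj M) ≡ det M
    det-adj (mat a b c d) = solve 4 (λ a b c d → d :* a :- (:- b) :* (:- c) := a :* d :- b :* c) refl a b c d

  -- Opaque, since the case distinctions of möbius make conversion checking very slow.
  opaque

    apply : Mat → X → X
    apply (mat a b c d) = möbius a b c d

    apply≡möbius : ∀ a b c d P → apply (mat a b c d) P ≡ möbius a b c d P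
    apply≡möbius a b c d P = refl

  -- The action in homogeneous coordinates, up to a nonzero scale. It has neither division nor a
  -- special case at ∞, so statements about it are polynomial identities for the ring solver.
  record Maps (M : Mat) (P R : X) : Set where
    constructor maps
    open Mat M
    field
      scale   : Fin q
      scale≢0 : scale ≢ 0#
      row₁    : a * hx P + b * hy P ≡ scale * hx R
      row₂    : c * hx P + d * hy P ≡ scale * hy R

  möbius≡point : ∀ a b c d P → möbius a b c d P ≡ point (a * hx P + b * hy P) (c * hx P + d * hy P)
  möbius≡point a b c d zero    = cong₂ point (first a b) (first c d)
    where
    first : ∀ a b → a ≡ a * 1# + b * 0#
    first = solve 2 (λ a b → a := a :* con (pos 1) :+ b :* con (pos 0)) refl
  möbius≡point a b c d (suc x) = cong₂ (λ u v → point (a * x + u) (c * x + v)) (sym (*-identityʳ b)) (sym (*-identityʳ d))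

  apply≡point : ∀ a b c d P → apply (mat a b c d) P ≡ point (a * hx P + b * hy P) (c * hx P + d * hy P)
  apply≡point a b c d P = trans (apply≡möbius a b c d P) (möbius≡point a b c d P)

  maps⇒apply : ∀ {M P R} → Maps M P R → apply M P ≡ R
  maps⇒apply {mat a b c d} {P} {R} (maps l l≢0 eq₁ eq₂) = trans (apply≡point a b c d P) (point-unique R l≢0 eq₁ eq₂)

  h≢0 : ∀ P → ¬ (hx P ≡ 0# × hy P ≡ 0#)
  h≢0 zero    (eq , _) = 1≢0 eq
  h≢0 (suc x) (_ , eq) = 1≢0 eq

  -- The adjugate recovers det M times the coordinates of P from the image vector, so that vector is
  -- nonzero and represents a point.
  apply-maps : ∀ M → det M ≢ 0# → ∀ P → Maps M P (apply M P)
  apply-maps (mat a b c d) det≢0 P rewrite apply≡point a b c d P = 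
    let l , l≢0 , eq₁ , eq₂ = scalar in maps l l≢0 eq₁ eq₂
    where
    x = hx P
    y = hy P
    combine : ∀ s t {u v} → u ≡ 0# → v ≡ 0# → s * u - t * v ≡ 0#
    combine s t refl refl = solve 2 (λ s t → s :* con (pos 0) :- t :* con (pos 0) := con (pos 0)) refl s t
    scalar = point-scalar λ (u≡0 , v≡0) → h≢0 P
      ( x*y≡0⇒y≡0 det≢0 (begin
          (a * d - b * c) * x                            ≡⟨ solve 6 (λ a b c d x y → (a :* d :- b :* c) :* x := d :* (a :* x :+ b :* y) :- b :* (c :* x :+ d :* y)) refl a b c d x y ⟩
          d * (a * x + b * y) - b * (c * x + d * y)      ≡⟨ combine d b u≡0 v≡0 ⟩
          0#                                             ∎)
      , x*y≡0⇒y≡0 det≢0 (begin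
          (a * d - b * c) * y                            ≡⟨ solve 6 (λ a b c d x y → (a :* d :- b :* c) :* y := a :* (c :* x :+ d :* y) :- c :* (a :* x :+ b :* y)) refl a b c d x y ⟩
          a * (c * x + d * y) - c * (a * x + b * y)      ≡⟨ combine a c v≡0 u≡0 ⟩
          0#                                             ∎))

  maps-⊗ : ∀ M N {P Q R} → Maps M Q R → Maps N P Q → Maps (M ⊗ N) P R
  maps-⊗ (mat a b c d) (mat a′ b′ c′ d′) {P} {Q} {R} (maps l l≢0 eq₁ eq₂) (maps m m≢0 eq₃ eq₄) =
    maps (m * l) (*-≢0 m≢0 l≢0) (row a b (hx R) eq₁) (row c d (hy R) eq₂)
    where
    row : ∀ s t z → s * hx Q + t * hy Q ≡ l * z →
          (s * a′ + t * c′) * hx P + (s * b′ + t * d′) * hy P ≡ m * l * z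
    row s t z eq = begin
      (s * a′ + t * c′) * hx P + (s * b′ + t * d′) * hy P
        ≡⟨ solve 8 (λ s t a′ b′ c′ d′ x y → (s :* a′ :+ t :* c′) :* x :+ (s :* b′ :+ t :* d′) :* y
                      := s :* (a′ :* x :+ b′ :* y) :+ t :* (c′ :* x :+ d′ :* y)) refl s t a′ b′ c′ d′ (hx P) (hy P) ⟩
      s * (a′ * hx P + b′ * hy P) + t * (c′ * hx P + d′ * hy P)
        ≡⟨ cong₂ (λ u v → s * u + t * v) eq₃ eq₄ ⟩
      s * (m * hx Q) + t * (m * hy Q)
        ≡⟨ solve 5 (λ s t m x y → s :* (m :* x) :+ t :* (m :* y) := m :* (s :* x :+ t :* y)) refl s t m (hx Q) (hy Q) ⟩
      m * (s * hx Q + t * hy Q)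
        ≡⟨ cong (m *_) eq ⟩
      m * (l * z)
        ≡⟨ *-assoc m l z ⟨
      m * l * z ∎

  -- `adj M ⊗ M` is the scalar matrix with entry det M, which maps every point to itself.
  maps-cancel : ∀ M {P Q} → det M ≢ 0# → Maps (adj M ⊗ M) P Q → P ≡ Q
  maps-cancel (mat a b c d) {P} {Q} det≢0 m =
    trans (sym (maps⇒apply {mat d (- b) (- c) a ⊗ mat a b c d} {P} {P} (maps (a * d - b * c) det≢0
      (solve 6 (λ a b c d x y → (d :* a :+ (:- b) :* c) :* x :+ (d :* b :+ (:- b) :* d) :* y := (a :* d :- b :* c) :* x) refl a b c d (hx P) (hy P))
      (solve 6 (λ a b c d x y → ((:- c) :* a :+ a :* c) :* x :+ ((:- c) :* b :+ a :* d) :* y := (a :* d :- b :* c) :* y) refl a b c d (hx P) (hy P)))))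
      (maps⇒apply m)

  maps-cancel′ : ∀ M {P Q} → det M ≢ 0# → Maps (M ⊗ adj M) P Q → P ≡ Q
  maps-cancel′ (mat a b c d) {P} {Q} det≢0 m =
    trans (sym (maps⇒apply {mat a b c d ⊗ mat d (- b) (- c) a} {P} {P} (maps (a * d - b * c) det≢0
      (solve 6 (λ a b c d x y → (a :* d :+ b :* (:- c)) :* x :+ (a :* (:- b) :+ b :* a) :* y := (a :* d :- b :* c) :* x) refl a b c d (hx P) (hy P))
      (solve 6 (λ a b c d x y → (c :* d :+ d :* (:- c)) :* x :+ (c :* (:- b) :+ d :* a) :* y := (a :* d :- b :* c) :* y) refl a b c d (hx P) (hy P)))))
      (maps⇒apply m)

  record GL : Set where
    constructor gl
    field
      matrix : Mat
      det≢0  : det matrix ≢ 0#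
  open GL public

  act : GL → X → X
  act g = apply (matrix g)

  act-maps : ∀ g P → Maps (matrix g) P (act g P)
  act-maps g = apply-maps (matrix g) (det≢0 g)

  infixl 7 _∙_
  _∙_ : GL → GL → GL
  gl M m ∙ gl N n = gl (M ⊗ N) (λ eq → *-≢0 m n (trans (sym (det-⊗ M N)) eq))

  inv : GL → GL
  inv (gl M m) = gl (adj M) (λ eq → m (trans (sym (det-adj M)) eq))

  opaque

    act-∙ : ∀ g h P → act (g ∙ h) P ≡ act g (act h P)
    act-∙ g h P = maps⇒apply (maps-⊗ (matrix g) (matrix h) (act-maps g (act h P)) (act-maps h P))

    act-inv-act : ∀ g P → act (inv g) (act g P) ≡ P
    act-inv-act g P = sym (maps-cancel (matrix g) (det≢0 g)
      (maps-⊗ (adj (matrix g)) (matrix g) (act-maps (inv g) (act g P)) (act-maps g P)))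

    act-act-inv : ∀ g P → act g (act (inv g) P) ≡ P
    act-act-inv g P = sym (maps-cancel′ (matrix g) (det≢0 g)
      (maps-⊗ (matrix g) (adj (matrix g)) (act-maps g (act (inv g) P)) (act-maps (inv g) P)))

    act-injective : ∀ g {P Q} → act g P ≡ act g Q → P ≡ Q
    act-injective g {P} {Q} eq = trans (sym (act-inv-act g P)) (trans (cong (act (inv g)) eq) (act-inv-act g Q))

  -- The 2 × 2 determinant of homogeneous coordinates, zero only for equal points.
  bracket : X → X → Fin q
  bracket P Q = hx P * hy Q - hy P * hx Q

  bracket≢0 : ∀ {P Q} → P ≢ Q → bracket P Q ≢ 0#
  bracket≢0 {zero}  {zero}  P≢Q _  = P≢Q refl
  bracket≢0 {zero}  {suc y} P≢Q eq = 1≢0 (trans (solve 1 (λ y → con (pos 1) := con (pos 1) :* con (pos 1) :- con (pos 0) :* y) refl y) eq)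
  bracket≢0 {suc x} {zero}  P≢Q eq = 1≢0 (trans (solve 1 (λ x → con (pos 1) := :- (x :* con (pos 0) :- con (pos 1) :* con (pos 1))) refl x) (trans (cong -_ eq) -0#≈0#))
  bracket≢0 {suc x} {suc y} P≢Q eq = P≢Q (cong suc (x-y≡0⇒x≡y
    (trans (solve 2 (λ x y → x :- y := x :* con (pos 1) :- con (pos 1) :* y) refl x y) eq)))

  -- The columns of the matrix represent P and Q; the scales `s` and `t` are chosen so that the
  -- columns add up to a multiple of R. Thus ∞, 0, 1 go to P, Q, R.
  module Frame (P Q R : X) (P≢Q : P ≢ Q) (P≢R : P ≢ R) (Q≢R : Q ≢ R) where

    private
      s = bracket R Q
      t = bracket P R

    opaque

      frame-det≢0 : s * hx P * (t * hy Q) - t * hx Q * (s * hy P) ≢ 0#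
      frame-det≢0 eq = *-≢0 (*-≢0 (bracket≢0 (≢-sym Q≢R)) (bracket≢0 P≢R)) (bracket≢0 P≢Q)
        (trans (solve 6 (λ s t x y x′ y′ → s :* t :* (x :* y′ :- y :* x′) := s :* x :* (t :* y′) :- t :* x′ :* (s :* y))
          refl s t (hx P) (hy P) (hx Q) (hy Q)) eq)

    frame : GL
    frame = gl (mat (s * hx P) (t * hx Q) (s * hy P) (t * hy Q)) frame-det≢0

    frame-∞ : act frame ∞ ≡ P
    frame-∞ = maps⇒apply {matrix frame} {∞} {P} (maps s (bracket≢0 (≢-sym Q≢R)) (first _ _) (first _ _))
      where
      first : ∀ a b → a * 1# + b * 0# ≡ a
      first = solve 2 (λ a b → a :* con (pos 1) :+ b :* con (pos 0) := a) refl

    frame-0 : act frame (suc 0#) ≡ Q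
    frame-0 = maps⇒apply {matrix frame} {suc 0#} {Q} (maps t (bracket≢0 P≢R) (second _ _) (second _ _))
      where
      second : ∀ a b → a * 0# + b * 1# ≡ b
      second = solve 2 (λ a b → a :* con (pos 0) :+ b :* con (pos 1) := b) refl

    -- The Plücker relation [R,Q] P + [P,R] Q = [P,Q] R.
    frame-1 : act frame (suc 1#) ≡ R
    frame-1 = maps⇒apply {matrix frame} {suc 1#} {R} (maps (bracket P Q) (bracket≢0 P≢Q)
      (solve 6 (λ x y x′ y′ x″ y″ →
        (x″ :* y′ :- y″ :* x′) :* x :* con (pos 1) :+ (x :* y″ :- y :* x″) :* x′ :* con (pos 1) := (x :* y′ :- y :* x′) :* x″)
        refl (hx P) (hy P) (hx Q) (hy Q) (hx R) (hy R))
      (solve 6 (λ x y x′ y′ x″ y″ →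
        (x″ :* y′ :- y″ :* x′) :* y :* con (pos 1) :+ (x :* y″ :- y :* x″) :* y′ :* con (pos 1) := (x :* y′ :- y :* x′) :* y″)
        refl (hx P) (hy P) (hx Q) (hy Q) (hx R) (hy R)))

  -- Fixing ∞ gives c = 0, fixing 0 gives b = 0, and fixing 1 gives a + b = c + d, so the matrix is
  -- scalar.
  fixes-∞01⇒identity : ∀ g → act g ∞ ≡ ∞ → act g (suc 0#) ≡ suc 0# → act g (suc 1#) ≡ suc 1# → ∀ P → act g P ≡ P
  fixes-∞01⇒identity g@(gl (mat a b c d) _) g∞ g0 g1 P
    with act g ∞ in eq∞ | act-maps g ∞ | act g (suc 0#) in eq0 | act-maps g (suc 0#) | act g (suc 1#) in eq1 | act-maps g (suc 1#)
  fixes-∞01⇒identity g@(gl (mat a b c d) _) refl refl refl P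
    | _ | maps l _ _ ∞₂ | _ | maps m _ 0₁ _ | _ | maps n n≢0 1₁ 1₂ =
    maps⇒apply {mat a b c d} {P} {P} (maps n n≢0 row₁ row₂)
    where
    c≡0 : c ≡ 0#
    c≡0 = trans (solve 2 (λ c d → c := c :* con (pos 1) :+ d :* con (pos 0)) refl c d) (trans ∞₂ (zeroʳ l))
    b≡0 : b ≡ 0#
    b≡0 = trans (solve 2 (λ a b → b := a :* con (pos 0) :+ b :* con (pos 1)) refl a b) (trans 0₁ (zeroʳ m))
    row₁ : a * hx P + b * hy P ≡ n * hx P
    row₁ = begin
      a * hx P + b * hy P                 ≡⟨ solve 4 (λ a b x y → a :* x :+ b :* y := (a :* con (pos 1) :+ b :* con (pos 1)) :* x :+ b :* (y :- x)) refl a b (hx P) (hy P) ⟩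
      (a * 1# + b * 1#) * hx P + b * (hy P - hx P)
                                          ≡⟨ cong₂ (λ u v → u * hx P + v * (hy P - hx P)) 1₁ b≡0 ⟩
      n * 1# * hx P + 0# * (hy P - hx P)  ≡⟨ solve 3 (λ n x z → n :* con (pos 1) :* x :+ con (pos 0) :* z := n :* x) refl n (hx P) (hy P - hx P) ⟩
      n * hx P                            ∎
    row₂ : c * hx P + d * hy P ≡ n * hy P
    row₂ = begin
      c * hx P + d * hy P                 ≡⟨ solve 4 (λ c d x y → c :* x :+ d :* y := (c :* con (pos 1) :+ d :* con (pos 1)) :* y :+ c :* (x :- y)) refl c d (hx P) (hy P) ⟩
      (c * 1# + d * 1#) * hy P + c * (hx P - hy P)
                                          ≡⟨ cong₂ (λ u v → u * hy P + v * (hx P - hy P)) 1₂ c≡0 ⟩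
      n * 1# * hy P + 0# * (hx P - hy P)  ≡⟨ solve 3 (λ n x z → n :* con (pos 1) :* x :+ con (pos 0) :* z := n :* x) refl n (hy P) (hx P - hy P) ⟩
      n * hy P                            ∎

  Distinct : X → X → X → Set
  Distinct P Q R = P ≢ Q × P ≢ R × Q ≢ R

  -- Conjugation by a frame moves the three fixed points to ∞, 0, 1.
  fixes-3⇒identity : ∀ g {P Q R} → Distinct P Q R →
    act g P ≡ P → act g Q ≡ Q → act g R ≡ R → ∀ S → act g S ≡ S
  fixes-3⇒identity g {P} {Q} {R} (P≢Q , P≢R , Q≢R) gP gQ gR S = begin
    act g S                                        ≡⟨ cong (act g) (act-act-inv frame S) ⟨
    act g (act frame S′)                           ≡⟨ act-act-inv frame _ ⟨
    act frame (act (inv frame) (act g (act frame S′))) ≡⟨ cong (act frame) (expand S′) ⟨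
    act frame (act conj S′)                        ≡⟨ cong (act frame) (fixes-∞01⇒identity conj (fixed {∞} frame-∞ gP) (fixed {suc 0#} frame-0 gQ) (fixed {suc 1#} frame-1 gR) S′) ⟩
    act frame S′                                   ≡⟨ act-act-inv frame S ⟩
    S                                              ∎
    where
    open Frame P Q R P≢Q P≢R Q≢R
    S′ = act (inv frame) S
    conj = inv frame ∙ (g ∙ frame)
    expand : ∀ T → act conj T ≡ act (inv frame) (act g (act frame T))
    expand T = trans (act-∙ (inv frame) (g ∙ frame) T) (cong (act (inv frame)) (act-∙ g frame T))
    fixed : ∀ {T U} → act frame T ≡ U → act g U ≡ U → act conj T ≡ T
    fixed {T} refl gU = trans (expand T) (trans (cong (act (inv frame)) gU) (act-inv-act frame T))

  agree-3⇒equal : ∀ g h {P Q R} → Distinct P Q R →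
    act g P ≡ act h P → act g Q ≡ act h Q → act g R ≡ act h R → ∀ S → act g S ≡ act h S
  agree-3⇒equal g h dist eqP eqQ eqR S = begin
    act g S                               ≡⟨ act-act-inv h _ ⟨
    act h (act (inv h) (act g S))         ≡⟨ cong (act h) (act-∙ (inv h) g S) ⟨
    act h (act (inv h ∙ g) S)             ≡⟨ cong (act h) (fixes-3⇒identity (inv h ∙ g) dist (fixed eqP) (fixed eqQ) (fixed eqR) S) ⟩
    act h S                               ∎
    where
    fixed : ∀ {T} → act g T ≡ act h T → act (inv h ∙ g) T ≡ T
    fixed {T} eq = trans (act-∙ (inv h) g T) (trans (cong (act (inv h)) eq) (act-inv-act h T))

  record Transport (P Q R P′ Q′ R′ : X) : Set where
    field
      element : GL
      at₁ : act element P ≡ P′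
      at₂ : act element Q ≡ Q′
      at₃ : act element R ≡ R′

  transport : ∀ {P Q R P′ Q′ R′} → Distinct P Q R → Distinct P′ Q′ R′ → Transport P Q R P′ Q′ R′
  transport {P} {Q} {R} {P′} {Q′} {R′} (P≢Q , P≢R , Q≢R) (P′≢Q′ , P′≢R′ , Q′≢R′) = record
    { element = B.frame ∙ inv A.frame
    ; at₁ = carry {∞} A.frame-∞ B.frame-∞
    ; at₂ = carry {suc 0#} A.frame-0 B.frame-0
    ; at₃ = carry {suc 1#} A.frame-1 B.frame-1
    }
    where
    module A = Frame P Q R P≢Q P≢R Q≢R
    module B = Frame P′ Q′ R′ P′≢Q′ P′≢R′ Q′≢R′
    carry : ∀ {S T U} → act A.frame S ≡ T → act B.frame S ≡ U → act (B.frame ∙ inv A.frame) T ≡ U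
    carry {S} refl refl = trans (act-∙ B.frame (inv A.frame) (act A.frame S)) (cong (act B.frame) (act-inv-act A.frame S))

-- Möbius maps preserving B

module BlockStabiliser {q′ : ℕ} (F : FiniteField (suc q′)) where

  open import Data.Nat as ℕ using (zero; s≤s; z≤n)
  import Data.Nat.Properties as ℕ
  open import Data.Nat.Combinatorics using (_C_; nC1≡n)
  open import Data.Nat.Divisibility using (_∣_; divides; ∣m+n∣m⇒∣n; ∣m⇒∣m*n; m∣m*n)
  open import Data.Nat.Primality using (Prime; prime⇒nonZero)
  open import Data.Integer using () renaming (+_ to pos)
  open import Data.Fin as Fin using (Fin; zero; suc; _≟_)
  open import Function using (_∘_)
  open import Relation.Nullary.Decidable using (decidable-stable)
  open import Relation.Unary using (Decidable)
  open ≡-Reasoning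
  open PrimePowers
  open FieldTheory F
  open ProjectiveLine F
  open PrimitiveElements F

  x^n≡0⇒x≡0 : ∀ {x} n → x ^ n ≡ 0# → x ≡ 0#
  x^n≡0⇒x≡0 {x} n eq = decidable-stable (x ≟ 0#) (λ x≢0 → ^≢0 n x≢0 eq)

  module Stabiliser
    {p n : ℕ} (pr : Prime p) (1≤n : 1 ℕ.≤ n) (q≡p^n : suc q′ ≡ p ℕ.^ n)
    (θ : Fin (suc q′)) (generates : Primitive θ)
    {k₁ r : ℕ} (3≤k₁ : 3 ℕ.≤ k₁) (1≤r : 1 ℕ.≤ r) (q′≡kr : q′ ≡ suc k₁ ℕ.* r) where

    k : ℕ
    k = suc k₁

    k≤q′ : k ℕ.≤ q′
    k≤q′ = subst (k ℕ.≤_) (sym q′≡kr) (ℕ.m≤m*n k r {{ℕ.>-nonZero 1≤r}})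

    open PrimitiveElement θ generates (ℕ.≤-trans (s≤s (ℕ.≤-trans (s≤s z≤n) 3≤k₁)) k≤q′) public
    open Subgroup {k} {r} q′≡kr public
    open Characteristic pr (p⋆1≡0 p n q≡p^n) public

    p∣q : p ∣ suc q′
    p∣q = subst (p ∣_) (sym q≡p^n) (divides-pow 1≤n)
      where
      divides-pow : ∀ {n} → 1 ℕ.≤ n → p ∣ p ℕ.^ n
      divides-pow {suc n} _ = m∣m*n (p ℕ.^ n)

    -- Otherwise p would divide both q - 1 = k r and q.
    p∤k : ¬ p ∣ k
    p∤k p∣k = p∤1 pr (∣m+n∣m⇒∣n (subst (p ∣_) (ℕ.+-comm 1 q′) p∣q)
      (subst (p ∣_) (sym q′≡kr) (∣m⇒∣m*n r p∣k)))

    -- B as the solution set of x^k = 1: a decidable condition that turns preservation of B into a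
    -- polynomial identity on B.
    OnB : X → Set
    OnB zero    = ⊥
    OnB (suc x) = x ^ k ≡ 1#

    OnB? : Decidable OnB
    OnB? zero    = no λ ()
    OnB? (suc x) = x ^ k ≟ 1#

    Preserves : GL → Set
    Preserves g = ∀ P → OnB P → OnB (act g P)

    maps-OnB : ∀ {a b c d x P} → Maps (mat a b c d) (suc x) P → OnB P →
               (a * x + b) ^ k ≡ (c * x + d) ^ k
    maps-OnB {a} {b} {c} {d} {x} {suc y} (maps l l≢0 eq₁ eq₂) y^k≡1 = begin
      (a * x + b) ^ k       ≡⟨ cong (λ z → (a * x + z) ^ k) (*-identityʳ b) ⟨
      (a * x + b * 1#) ^ k  ≡⟨ cong (_^ k) eq₁ ⟩
      (l * y) ^ k           ≡⟨ ^-distrib-* l y k ⟩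
      l ^ k * y ^ k         ≡⟨ cong (l ^ k *_) y^k≡1 ⟩
      l ^ k * 1#            ≡⟨ *-identityʳ _ ⟩
      l ^ k                 ≡⟨ cong (_^ k) (*-identityʳ l) ⟨
      (l * 1#) ^ k          ≡⟨ cong (_^ k) eq₂ ⟨
      (c * x + d * 1#) ^ k  ≡⟨ cong (λ z → (c * x + z) ^ k) (*-identityʳ d) ⟩
      (c * x + d) ^ k       ∎

    maps-OnB⁻ : ∀ {a b c d x P} → Maps (mat a b c d) (suc x) P →
                (a * x + b) ^ k ≡ (c * x + d) ^ k → OnB P
    -- The image ∞ is impossible: the denominator would be 0 and the numerator the nonzero scale.
    maps-OnB⁻ {a} {b} {c} {d} {x} {zero} (maps l l≢0 eq₁ eq₂) eq = ^≢0 k l≢0 (begin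
      l ^ k                 ≡⟨ cong (_^ k) (trans (sym (*-identityʳ l)) (sym eq₁)) ⟩
      (a * x + b * 1#) ^ k  ≡⟨ cong (λ z → (a * x + z) ^ k) (*-identityʳ b) ⟩
      (a * x + b) ^ k       ≡⟨ eq ⟩
      (c * x + d) ^ k       ≡⟨ cong (λ z → (c * x + z) ^ k) (*-identityʳ d) ⟨
      (c * x + d * 1#) ^ k  ≡⟨ cong (_^ k) (trans eq₂ (zeroʳ l)) ⟩
      0# ^ k                ≡⟨ zeroˡ _ ⟩
      0#                    ∎)
    maps-OnB⁻ {a} {b} {c} {d} {x} {suc y} (maps l l≢0 eq₁ eq₂) eq = *-cancelˡ (^≢0 k l≢0) (begin
      l ^ k * y ^ k         ≡⟨ ^-distrib-* l y k ⟨
      (l * y) ^ k           ≡⟨ cong (_^ k) eq₁ ⟨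
      (a * x + b * 1#) ^ k  ≡⟨ cong (λ z → (a * x + z) ^ k) (*-identityʳ b) ⟩
      (a * x + b) ^ k       ≡⟨ eq ⟩
      (c * x + d) ^ k       ≡⟨ cong (λ z → (c * x + z) ^ k) (*-identityʳ d) ⟨
      (c * x + d * 1#) ^ k  ≡⟨ cong (_^ k) (trans eq₂ (*-identityʳ l)) ⟩
      l ^ k                 ≡⟨ *-identityʳ _ ⟨
      l ^ k * 1#            ∎)

    -- On B the polynomial (aX + b)^k - (cX + d)^k agrees with its reduction modulo X^k - 1,
    -- which has degree below k and k roots.
    coefficients : ∀ {a b c d} → (∀ x → x ^ k ≡ 1# → (a * x + b) ^ k ≡ (c * x + d) ^ k) →
      ∀ i → i ℕ.< k₁ → ¬ p ∣ k C suc i →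
      a ^ suc i * b ^ (k₁ ℕ.∸ i) ≡ c ^ suc i * d ^ (k₁ ℕ.∸ i)
    coefficients {a} {b} {c} {d} eq i i<k₁ p∤C = x-y≡0⇒x≡y (m⋆x≡0⇒x≡0 p∤C (begin
      (k C suc i) ⋆ (u - v)                            ≡⟨ ⋆1 (k C suc i) (u - v) ⟩
      (k C suc i) ⋆ 1# * (u - v)                       ≡⟨ solve 3 (λ m u v → m :* (u :- v) := m :* u :- m :* v) refl ((k C suc i) ⋆ 1#) u v ⟩
      (k C suc i) ⋆ 1# * u - (k C suc i) ⋆ 1# * v      ≡⟨ cong₂ _-_ (⋆1 (k C suc i) u) (⋆1 (k C suc i) v) ⟨
      f (suc i)                                        ≡⟨ n-roots⇒zero g k (β ^_) β^-distinct (λ j _ → root (β ^ j) ([β^i]^k≡1 j)) (suc i) (s≤s i<k₁) ⟩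
      0#                                               ∎))
      where
      u = a ^ suc i * b ^ (k₁ ℕ.∸ i)
      v = c ^ suc i * d ^ (k₁ ℕ.∸ i)
      f : ℕ → Fin (suc q′)
      f j = binom a b k j - binom c d k j
      g : ℕ → Fin (suc q′)
      g zero    = f 0 + f k
      g (suc j) = f (suc j)
      root : ∀ x → x ^ k ≡ 1# → eval g k x ≡ 0#
      root x x^k≡1 = begin
        f 0 + f k + x * eval (f ∘ suc) k₁ x         ≡⟨ solve 3 (λ s t y → s :+ t :+ y := s :+ y :+ t :* con (pos 1)) refl (f 0) (f k) (x * eval (f ∘ suc) k₁ x) ⟩
        f 0 + x * eval (f ∘ suc) k₁ x + f k * 1#    ≡⟨ cong (λ z → eval f k x + f k * z) x^k≡1 ⟨
        eval f k x + f k * x ^ k                    ≡⟨ eval-snoc f k x ⟨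
        eval f (suc k) x                            ≡⟨ eval-minus (binom a b k) (binom c d k) (suc k) x ⟩
        eval (binom a b k) (suc k) x - eval (binom c d k) (suc k) x
                                                  ≡⟨ cong₂ _-_ (binomial-eval a b k x) (binomial-eval c d k x) ⟨
        (a * x + b) ^ k - (c * x + d) ^ k         ≡⟨ x≡y⇒x-y≡0 (eq x x^k≡1) ⟩
        0#                                        ∎

    -- Raising to the further power q / p^m turns x^(p^m) into x^q = x.
    ^p^m-injective : ∀ m {x y} → p ℕ.^ m ∣ suc q′ → x ^ (p ℕ.^ m) ≡ y ^ (p ℕ.^ m) → x ≡ y
    ^p^m-injective m {x} {y} (divides s q≡) eq = begin
      x                              ≡⟨ x^q≡x x ⟨
      x ^ suc q′                     ≡⟨ cong (x ^_) q≡′ ⟩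
      x ^ (p ℕ.^ m ℕ.* s)            ≡⟨ ^-* x (p ℕ.^ m) s ⟩
      (x ^ (p ℕ.^ m)) ^ s            ≡⟨ cong (_^ s) eq ⟩
      (y ^ (p ℕ.^ m)) ^ s            ≡⟨ ^-* y (p ℕ.^ m) s ⟨
      y ^ (p ℕ.^ m ℕ.* s)            ≡⟨ cong (y ^_) q≡′ ⟨
      y ^ suc q′                     ≡⟨ x^q≡x y ⟩
      y                              ∎
      where
      q≡′ = trans q≡ (ℕ.*-comm s (p ℕ.^ m))

    -- Since k - 1 < q = p^n, the bound on p^m forces m ≤ n.
    p^m∣q : ∀ m → p ℕ.^ m ℕ.≤ k₁ → p ℕ.^ m ∣ suc q′
    p^m∣q m p^m≤k₁ = divides (p ℕ.^ (n ℕ.∸ m)) (begin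
      suc q′                              ≡⟨ q≡p^n ⟩
      p ℕ.^ n                             ≡⟨ cong (p ℕ.^_) (ℕ.m∸n+n≡m m≤n) ⟨
      p ℕ.^ (n ℕ.∸ m ℕ.+ m)               ≡⟨ ℕ.^-distribˡ-+-* p (n ℕ.∸ m) m ⟩
      p ℕ.^ (n ℕ.∸ m) ℕ.* p ℕ.^ m         ∎)
      where
      m≤n : m ℕ.≤ n
      m≤n = ℕ.≮⇒≥ λ n<m → ℕ.<⇒≱
        (subst (k₁ ℕ.<_) q≡p^n (ℕ.≤-trans k≤q′ (ℕ.n≤1+n q′)))
        (ℕ.≤-trans (ℕ.^-monoʳ-≤ p {{prime⇒nonZero pr}} (ℕ.<⇒≤ n<m)) p^m≤k₁)

    -- `E₁` makes zero entries occur in pairs, and a nonzero determinant admits only the diagonal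
    -- and the antidiagonal pair. `generic` excludes the absence of zeros by multiplying `E₂` with
    -- `E₁` reversed.
    linear-or-inverse : ¬ k₁ ∣ suc q′ → ∀ {a b c d} → a * d - b * c ≢ 0# →
      (∀ x → x ^ k ≡ 1# → (a * x + b) ^ k ≡ (c * x + d) ^ k) →
      (b ≡ 0# × c ≡ 0#) ⊎ (a ≡ 0# × d ≡ 0#)
    linear-or-inverse k₁∤q {a} {b} {c} {d} det≢0 eq with p-part pr k₁ (ℕ.≤-trans (s≤s z≤n) 3≤k₁)
    ... | m , 0 , k₁≡ , p∤u = contradiction (divides 0 refl) p∤u
    ... | m , 1 , k₁≡ , p∤u = contradiction
          (subst (_∣ suc q′) (sym k₁≡Q) (p^m∣q m (ℕ.≤-reflexive (sym k₁≡Q)))) k₁∤q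
      where k₁≡Q = trans k₁≡ (ℕ.*-identityʳ (p ℕ.^ m))
    ... | m , u@(suc (suc u′)) , k₁≡ , p∤u = cases
      where
      Q = p ℕ.^ m
      w = Q ℕ.* suc u′
      k₁≡Q+w : k₁ ≡ Q ℕ.+ w
      k₁≡Q+w = trans k₁≡ (ℕ.*-suc Q (suc u′))
      Q>0 : 0 ℕ.< Q
      Q>0 = ℕ.m^n>0 p {{prime⇒nonZero pr}} m
      -- u ≥ 2 gives w > 0, so i = Q + 1 stays below k; at i = k the coefficient would be merged
      -- with the constant one modulo X^k - 1.
      Q<k₁ : Q ℕ.< k₁
      Q<k₁ = subst (Q ℕ.<_) (sym k₁≡Q+w) (ℕ.m<m+n Q (ℕ.*-mono-≤ Q>0 (s≤s (z≤n {u′}))))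
      -- `coefficients` is indexed by i - 1: its argument is 0 for i = 1, where C(k,1) = k, and Q
      -- for i = Q + 1.
      E₁ : a * b ^ k₁ ≡ c * d ^ k₁
      E₁ = trans (cong (_* b ^ k₁) (sym (*-identityʳ a)))
             (trans (coefficients eq 0 (ℕ.≤-trans (s≤s z≤n) 3≤k₁) (subst (λ z → ¬ p ∣ z) (sym (nC1≡n k)) p∤k))
                    (cong (_* d ^ k₁) (*-identityʳ c)))
      E₂ : a ^ suc Q * b ^ w ≡ c ^ suc Q * d ^ w
      E₂ = subst (λ z → a ^ suc Q * b ^ z ≡ c ^ suc Q * d ^ z)
             (trans (cong (ℕ._∸ Q) k₁≡Q+w) (ℕ.m+n∸m≡n Q w))
             (coefficients eq Q Q<k₁ (subst (λ z → ¬ p ∣ suc z C suc Q) (sym k₁≡)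
               (p∤[1+N]C[1+p^m] pr m u p∤u (subst (λ z → ¬ p ∣ suc z) k₁≡ p∤k))))
      singular : a * d ≡ b * c → ⊥
      singular ad≡bc = det≢0 (x≡y⇒x-y≡0 ad≡bc)
      generic : a ≢ 0# → b ≢ 0# → c ≢ 0# → d ≢ 0# → ⊥
      generic a≢0 b≢0 c≢0 d≢0 = singular (^p^m-injective m (p^m∣q m (ℕ.<⇒≤ Q<k₁)) (begin
        (a * d) ^ Q     ≡⟨ ^-distrib-* a d Q ⟩
        a ^ Q * d ^ Q   ≡⟨ *-cancelˡ (*-≢0 (*-≢0 a≢0 c≢0) (*-≢0 (^≢0 w b≢0) (^≢0 w d≢0))) main ⟩
        b ^ Q * c ^ Q   ≡⟨ ^-distrib-* b c Q ⟨
        (b * c) ^ Q     ∎))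
        where
        split : ∀ z → z ^ k₁ ≡ z ^ Q * z ^ w
        split z = trans (cong (z ^_) k₁≡Q+w) (^-+ z Q w)
        main : a * c * (b ^ w * d ^ w) * (a ^ Q * d ^ Q) ≡ a * c * (b ^ w * d ^ w) * (b ^ Q * c ^ Q)
        main = begin
          a * c * (b ^ w * d ^ w) * (a ^ Q * d ^ Q)
            ≡⟨ solve 6 (λ a c bw dw aQ dQ → a :* c :* (bw :* dw) :* (aQ :* dQ) := a :* aQ :* bw :* (c :* (dQ :* dw))) refl a c (b ^ w) (d ^ w) (a ^ Q) (d ^ Q) ⟩
          a * a ^ Q * b ^ w * (c * (d ^ Q * d ^ w))
            ≡⟨ cong₂ _*_ E₂ (trans (cong (c *_) (sym (split d))) (sym E₁)) ⟩
          c * c ^ Q * d ^ w * (a * b ^ k₁)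
            ≡⟨ cong (λ z → c * c ^ Q * d ^ w * (a * z)) (split b) ⟩
          c * c ^ Q * d ^ w * (a * (b ^ Q * b ^ w))
            ≡⟨ solve 6 (λ a c bw dw bQ cQ → c :* cQ :* dw :* (a :* (bQ :* bw)) := a :* c :* (bw :* dw) :* (bQ :* cQ)) refl a c (b ^ w) (d ^ w) (b ^ Q) (c ^ Q) ⟩
          a * c * (b ^ w * d ^ w) * (b ^ Q * c ^ Q) ∎
      left-zero : ∀ {x y z} → x ≡ 0# → x * y ≡ z → z ≡ 0#
      left-zero {y = y} refl eq = trans (sym eq) (zeroˡ y)
      0^k₁ : ∀ x {y} → y ≡ 0# → x * y ^ k₁ ≡ 0#
      0^k₁ x {y} refl = trans (cong (λ e → x * 0# ^ e) (sym (ℕ.suc-pred k₁ {{ℕ.>-nonZero (ℕ.≤-trans (s≤s z≤n) 3≤k₁)}})))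
        (trans (cong (x *_) (zeroˡ _)) (zeroʳ x))
      cases : (b ≡ 0# × c ≡ 0#) ⊎ (a ≡ 0# × d ≡ 0#)
      cases with a ≟ 0# | c ≟ 0#
      ... | yes a≡0 | yes c≡0 = ⊥-elim (singular (trans (trans (cong (_* d) a≡0) (zeroˡ d)) (sym (trans (cong (b *_) c≡0) (zeroʳ b)))))
      ... | yes a≡0 | no  c≢0 = inj₂ (a≡0 , x^n≡0⇒x≡0 k₁ (x*y≡0⇒y≡0 c≢0 (left-zero a≡0 E₁)))
      ... | no  a≢0 | yes c≡0 = inj₁ (x^n≡0⇒x≡0 k₁ (x*y≡0⇒y≡0 a≢0 (left-zero c≡0 (sym E₁))) , c≡0)
      ... | no  a≢0 | no  c≢0 with b ≟ 0# | d ≟ 0#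
      ...   | yes b≡0 | yes d≡0 = ⊥-elim (singular (trans (trans (cong (a *_) d≡0) (zeroʳ a)) (sym (trans (cong (_* c) b≡0) (zeroˡ c)))))
      ...   | yes b≡0 | no  d≢0 = ⊥-elim (*-≢0 c≢0 (^≢0 k₁ d≢0) (trans (sym E₁) (0^k₁ a b≡0)))
      ...   | no  b≢0 | yes d≡0 = ⊥-elim (*-≢0 a≢0 (^≢0 k₁ b≢0) (trans E₁ (0^k₁ c d≡0)))
      ...   | no  b≢0 | no  d≢0 = ⊥-elim (generic a≢0 b≢0 c≢0 d≢0)

    -- Among the maps s x and s / x, fixing 1 selects s = 1.
    preserves-fixing-1 : ¬ k₁ ∣ suc q′ → ∀ g → Preserves g → act g (suc 1#) ≡ suc 1# →
      (∀ {x y} → act g (suc x) ≡ suc y → x ≡ y) ⊎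
      (∀ {x y} → act g (suc x) ≡ suc y → x * y ≡ 1#)
    preserves-fixing-1 k₁∤q g@(gl (mat a b c d) det≢0) pres g1
      with subst (Maps (mat a b c d) (suc 1#)) g1 (act-maps g (suc 1#))
         | linear-or-inverse k₁∤q det≢0 (λ x x∈ → maps-OnB (act-maps g (suc x)) (pres (suc x) x∈))
    ... | maps l l≢0 eq₁ eq₂ | inj₁ (b≡0 , c≡0) = inj₁ linear
      where
      linear : ∀ {x y} → act g (suc x) ≡ suc y → x ≡ y
      linear {x} {y} gx with maps m m≢0 eq₃ eq₄ ← subst (Maps (mat a b c d) (suc x)) gx (act-maps g (suc x)) =
        *-cancelˡ m≢0 (begin
          m * x               ≡⟨ cong (_* x) (trans (sym (*-identityʳ m)) (sym eq₄)) ⟩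
          (c * x + d * 1#) * x ≡⟨ cong (λ z → (z * x + d * 1#) * x) c≡0 ⟩
          (0# * x + d * 1#) * x ≡⟨ solve 2 (λ d x → (con (pos 0) :* x :+ d :* con (pos 1)) :* x := (con (pos 0) :* con (pos 1) :+ d :* con (pos 1)) :* x) refl d x ⟩
          (0# * 1# + d * 1#) * x ≡⟨ cong (λ z → (z * 1# + d * 1#) * x) c≡0 ⟨
          (c * 1# + d * 1#) * x ≡⟨ cong (_* x) (trans eq₂ (sym eq₁)) ⟩
          (a * 1# + b * 1#) * x ≡⟨ cong (λ z → (a * 1# + z * 1#) * x) b≡0 ⟩
          (a * 1# + 0# * 1#) * x ≡⟨ solve 2 (λ a x → (a :* con (pos 1) :+ con (pos 0) :* con (pos 1)) :* x := a :* x :+ con (pos 0) :* con (pos 1)) refl a x ⟩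
          a * x + 0# * 1#      ≡⟨ cong (λ z → a * x + z * 1#) b≡0 ⟨
          a * x + b * 1#       ≡⟨ eq₃ ⟩
          m * y                ∎)
    ... | maps l l≢0 eq₁ eq₂ | inj₂ (a≡0 , d≡0) = inj₂ inverse
      where
      inverse : ∀ {x y} → act g (suc x) ≡ suc y → x * y ≡ 1#
      inverse {x} {y} gx with maps m m≢0 eq₃ eq₄ ← subst (Maps (mat a b c d) (suc x)) gx (act-maps g (suc x)) =
        *-cancelˡ m≢0 (begin
          m * (x * y)             ≡⟨ solve 3 (λ m x y → m :* (x :* y) := x :* (m :* y)) refl m x y ⟩
          x * (m * y)             ≡⟨ cong (x *_) eq₃ ⟨
          x * (a * x + b * 1#)    ≡⟨ cong (λ z → x * (z * x + b * 1#)) a≡0 ⟩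
          x * (0# * x + b * 1#)   ≡⟨ solve 2 (λ b x → x :* (con (pos 0) :* x :+ b :* con (pos 1)) := x :* (con (pos 0) :* con (pos 1) :+ b :* con (pos 1))) refl b x ⟩
          x * (0# * 1# + b * 1#)  ≡⟨ cong (λ z → x * (z * 1# + b * 1#)) a≡0 ⟨
          x * (a * 1# + b * 1#)   ≡⟨ cong (x *_) (trans eq₁ (sym eq₂)) ⟩
          x * (c * 1# + d * 1#)   ≡⟨ cong (λ z → x * (c * 1# + z * 1#)) d≡0 ⟩
          x * (c * 1# + 0# * 1#)  ≡⟨ solve 2 (λ c x → x :* (c :* con (pos 1) :+ con (pos 0) :* con (pos 1)) := c :* x :+ con (pos 0) :* con (pos 1)) refl c x ⟩
          c * x + 0# * 1#         ≡⟨ cong (λ z → c * x + z * 1#) d≡0 ⟨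
          c * x + d * 1#          ≡⟨ eq₄ ⟩
          m * 1#                  ∎)

    -- If k = p^m + 1 then x ↦ x^(p^m) inverts the elements of B, so on B the equation
    -- (ax + b)^k = (cx + d)^k is quadratic in x.
    module Subline {m} (k₁≡p^m : k₁ ≡ p ℕ.^ m) where

      quadratic : Fin (suc q′) → Fin (suc q′) → ℕ → Fin (suc q′)
      quadratic a b 0 = b * a ^ k₁
      quadratic a b 1 = a * a ^ k₁ + b * b ^ k₁
      quadratic a b _ = a * b ^ k₁

      -- The extra factor x clears a denominator: on B the additive power (a x + b)^(k-1) equals
      -- a^(k-1) / x + b^(k-1).
      quadratic-eval : ∀ a b x → x ^ k ≡ 1# → x * (a * x + b) ^ k ≡ eval (quadratic a b) 3 x
      quadratic-eval a b x x^k≡1 = begin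
        x * ((a * x + b) * (a * x + b) ^ k₁)
          ≡⟨ cong (λ z → x * ((a * x + b) * z)) frob ⟩
        x * ((a * x + b) * (a ^ k₁ * x ^ k₁ + b ^ k₁))
          ≡⟨ solve 6 (λ a b x A X B → x :* ((a :* x :+ b) :* (A :* X :+ B)) := (a :* x :+ b) :* (A :* (x :* X) :+ B :* x)) refl a b x (a ^ k₁) (x ^ k₁) (b ^ k₁) ⟩
        (a * x + b) * (a ^ k₁ * (x * x ^ k₁) + b ^ k₁ * x)
          ≡⟨ cong (λ z → (a * x + b) * (a ^ k₁ * z + b ^ k₁ * x)) x^k≡1 ⟩
        (a * x + b) * (a ^ k₁ * 1# + b ^ k₁ * x)
          ≡⟨ solve 5 (λ a b x A B → (a :* x :+ b) :* (A :* con (pos 1) :+ B :* x)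
               := b :* A :+ x :* (a :* A :+ b :* B :+ x :* (a :* B :+ x :* con (pos 0)))) refl a b x (a ^ k₁) (b ^ k₁) ⟩
        eval (quadratic a b) 3 x ∎
        where
        frob : (a * x + b) ^ k₁ ≡ a ^ k₁ * x ^ k₁ + b ^ k₁
        frob = begin
          (a * x + b) ^ k₁              ≡⟨ cong ((a * x + b) ^_) k₁≡p^m ⟩
          (a * x + b) ^ (p ℕ.^ m)       ≡⟨ frobenius m (a * x) b ⟩
          (a * x) ^ (p ℕ.^ m) + b ^ (p ℕ.^ m) ≡⟨ cong (λ e → (a * x) ^ e + b ^ e) k₁≡p^m ⟨
          (a * x) ^ k₁ + b ^ k₁         ≡⟨ cong (_+ b ^ k₁) (^-distrib-* a x k₁) ⟩
          a ^ k₁ * x ^ k₁ + b ^ k₁      ∎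

      three⇒preserves : ∀ g {P Q R} → Distinct P Q R → OnB P → OnB Q → OnB R →
        OnB (act g P) → OnB (act g Q) → OnB (act g R) → Preserves g
      three⇒preserves g@(gl (mat a b c d) _) {suc x} {suc y} {suc z} (x≢y , x≢z , y≢z) x∈ y∈ z∈ gx∈ gy∈ gz∈ = preserves
        where
        f : ℕ → Fin (suc q′)
        f i = quadratic a b i - quadratic c d i
        f-eval : ∀ x → x ^ k ≡ 1# → eval f 3 x ≡ x * ((a * x + b) ^ k - (c * x + d) ^ k)
        f-eval x x∈ = begin
          eval f 3 x                                          ≡⟨ eval-minus (quadratic a b) (quadratic c d) 3 x ⟩
          eval (quadratic a b) 3 x - eval (quadratic c d) 3 x   ≡⟨ cong₂ _-_ (quadratic-eval a b x x∈) (quadratic-eval c d x x∈) ⟨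
          x * (a * x + b) ^ k - x * (c * x + d) ^ k         ≡⟨ solve 3 (λ x s t → x :* s :- x :* t := x :* (s :- t)) refl x ((a * x + b) ^ k) ((c * x + d) ^ k) ⟩
          x * ((a * x + b) ^ k - (c * x + d) ^ k)           ∎
        root : ∀ x → x ^ k ≡ 1# → OnB (act g (suc x)) → eval f 3 x ≡ 0#
        root x x∈ gx∈ = trans (f-eval x x∈) (trans (cong (x *_) (x≡y⇒x-y≡0 (maps-OnB (act-maps g (suc x)) gx∈))) (zeroʳ x))
        ρ : ℕ → Fin (suc q′)
        ρ 0 = x
        ρ 1 = y
        ρ _ = z
        distinct : ∀ {i j} → i ℕ.< j → j ℕ.< 3 → ρ i ≢ ρ j
        distinct {0} {1} _ _ = x≢y ∘ cong suc
        distinct {0} {2} _ _ = x≢z ∘ cong suc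
        distinct {1} {2} _ _ = y≢z ∘ cong suc
        distinct {1} {1} (s≤s ()) _
        distinct {suc (suc _)} {1} (s≤s ()) _
        distinct {suc (suc _)} {2} (s≤s (s≤s ())) _
        distinct {_} {suc (suc (suc _))} _ (s≤s (s≤s (s≤s ())))
        roots : ∀ i → i ℕ.< 3 → eval f 3 (ρ i) ≡ 0#
        roots 0 _ = root x x∈ gx∈
        roots 1 _ = root y y∈ gy∈
        roots 2 _ = root z z∈ gz∈
        roots (suc (suc (suc _))) (s≤s (s≤s (s≤s ())))
        preserves : Preserves g
        -- Three roots annihilate the quadratic; the factor w brought in by `quadratic-eval` is
        -- nonzero and cancels.
        preserves (suc w) w∈ = maps-OnB⁻ (act-maps g (suc w)) (x-y≡0⇒x≡y (x*y≡0⇒y≡0 (x^k≡1⇒x≢0 w∈)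
          (trans (sym (f-eval w w∈)) (eval-zero 3 w (n-roots⇒zero f 3 ρ distinct roots)))))

-- The orbit of B as a design

module Orbit {q′ : ℕ} (F : FiniteField (suc q′)) where

  open import Data.Nat as ℕ using (zero; s≤s; z≤n)
  import Data.Nat.Properties as ℕ
  open import Data.Nat.Divisibility using (_∣_; _∣?_; ∣-trans; n∣m*n)
  open import Data.Nat.Primality using (Prime)
  open import Data.Integer using () renaming (+_ to pos)
  import Data.Bool as Bool
  open import Data.Fin as Fin using (Fin; zero; suc; _≟_)
  import Data.Fin.Properties as Fin
  open import Data.Fin.Subset using (Subset; _⊆_; ∣_∣) renaming (_∈_ to _∈ˢ_)
  open import Data.Fin.Subset.Properties using (_⊆?_; ⊆-antisym)
  open import Data.Vec.Properties using (≡-dec)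
  open import Data.List using (List; []; _∷_; length; filter; map; deduplicate; cartesianProduct; allFin; upTo)
  open import Data.List.Properties using (length-map; length-upTo)
  open import Data.List.Membership.Propositional using (_∈_)
  open import Data.List.Membership.Propositional.Properties
  open import Data.List.Relation.Unary.Any using (here)
  open import Data.List.Relation.Unary.All as All using (All; []; _∷_)
  open import Data.List.Relation.Unary.AllPairs using ([]; _∷_)
  open import Data.List.Relation.Unary.Unique.Propositional using (Unique)
  import Data.List.Relation.Unary.Unique.Propositional.Properties as Unique
  open import Function using (_∘_)
  open import Function.Bundles using (_⇔_; mk⇔; Equivalence)
  open import Relation.Binary.Definitions using (DecidableEquality; tri<; tri≈; tri>)
  open ≡-Reasoning
  open PrimePowers
  open Enumeration
  open FieldTheory F
  open ProjectiveLine F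
  open BlockStabiliser F

  _≟ˢ_ : ∀ {n} → DecidableEquality (Subset n)
  _≟ˢ_ = ≡-dec Bool._≟_

  open import Data.List.Relation.Unary.Unique.DecPropositional.Properties (_≟ˢ_ {suc (suc q′)}) using (deduplicate-!)

  module Design
    {p n : ℕ} (pr : Prime p) (1≤n : 1 ℕ.≤ n) (q≡p^n : suc q′ ≡ p ℕ.^ n)
    (θ : Fin (suc q′)) (generates : Primitive θ)
    {k₁ r : ℕ} (3≤k₁ : 3 ℕ.≤ k₁) (1≤r : 1 ℕ.≤ r) (q′≡kr : q′ ≡ suc k₁ ℕ.* r) where

    open Stabiliser pr 1≤n q≡p^n θ generates 3≤k₁ 1≤r q′≡kr

    OnB⇒β^ : ∀ {P} → OnB P → ∃[ i ] (i ℕ.< k × P ≡ suc (β ^ i))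
    OnB⇒β^ {suc x} x∈ with i , i<k , refl ← x^k≡1⇒x≡β^i x∈ = i , i<k , refl

    InB⇔OnB : ∀ {P} → InB θ r P ⇔ OnB P
    InB⇔OnB = mk⇔
      (λ { (_ , refl , i , refl) → [β^i]^k≡1 i })
      (λ P∈ → let i , _ , P≡ = OnB⇒β^ P∈ in β ^ i , P≡ , i , refl)

    -- The image of B, described through the inverse map so that membership is decidable; the
    -- adjugate acts as the inverse since scalars act trivially. A bare matrix as argument lets the
    -- orbit be enumerated without carrying determinant proofs.
    blockOf : Mat → Subset (suc (suc q′))
    blockOf M = satisfying λ P → OnB? (apply (adj M) P)

    block : GL → Subset (suc (suc q′))
    block g = blockOf (matrix g)

    opaque

      ∈-block⁺ : ∀ g {P} → OnB P → act g P ∈ˢ block g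
      ∈-block⁺ g {P} P∈ = ∈-satisfying⁺ (OnB? ∘ act (inv g)) (subst OnB (sym (act-inv-act g P)) P∈)

      ∈-block⁻ : ∀ g {R} → R ∈ˢ block g → ∃[ P ] (OnB P × act g P ≡ R)
      ∈-block⁻ g {R} R∈ = act (inv g) R , ∈-satisfying⁻ (OnB? ∘ act (inv g)) R∈ , act-act-inv g R

    block-cong : ∀ g h → (∀ P → act g P ≡ act h P) → block g ≡ block h
    block-cong g h eq = ⊆-antisym (sub g h eq) (sub h g (sym ∘ eq))
      where
      sub : ∀ g h → (∀ P → act g P ≡ act h P) → block g ⊆ block h
      sub g h eq R∈ with P , P∈ , refl ← ∈-block⁻ g R∈ = subst (_∈ˢ block h) (sym (eq P)) (∈-block⁺ h P∈)

    block-⊆ : ∀ g h → Preserves (inv h ∙ g) → block g ⊆ block h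
    block-⊆ g h pres R∈ with P , P∈ , refl ← ∈-block⁻ g R∈ =
      subst (_∈ˢ block h) (trans (cong (act h) (act-∙ (inv h) g P)) (act-act-inv h (act g P)))
        (∈-block⁺ h (pres P P∈))

    block≡⇒preserves : ∀ g h → block g ≡ block h → Preserves (inv h ∙ g)
    block≡⇒preserves g h eq P P∈
      with Q , Q∈ , hQ≡gP ← ∈-block⁻ h (subst (act g P ∈ˢ_) eq (∈-block⁺ g P∈)) =
      subst OnB (begin
        Q                              ≡⟨ act-inv-act h Q ⟨
        act (inv h) (act h Q)          ≡⟨ cong (act (inv h)) hQ≡gP ⟩
        act (inv h) (act g P)          ≡⟨ act-∙ (inv h) g P ⟨
        act (inv h ∙ g) P              ∎) Q∈

    block-∙ : ∀ h s → Preserves s → (∀ P → OnB P → ∃[ Q ] (OnB Q × act s Q ≡ P)) → block (h ∙ s) ≡ block h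
    block-∙ h s pres onto = ⊆-antisym forth back
      where
      forth : block (h ∙ s) ⊆ block h
      forth R∈ with P , P∈ , refl ← ∈-block⁻ (h ∙ s) R∈ =
        subst (_∈ˢ block h) (sym (act-∙ h s P)) (∈-block⁺ h (pres P P∈))
      back : block h ⊆ block (h ∙ s)
      back R∈ with P , P∈ , refl ← ∈-block⁻ h R∈ with Q , Q∈ , refl ← onto P P∈ =
        subst (_∈ˢ block (h ∙ s)) (act-∙ h s Q) (∈-block⁺ (h ∙ s) Q∈)

    InOrbit⇔block : ∀ S → (∃[ g ] (S ≡ block g)) ⇔ InOrbit θ r S
    InOrbit⇔block S = mk⇔
      (λ { (g@(gl (mat a b c d) det≢0) , refl) → a , b , c , d , det≢0 , λ R → mk⇔
        (λ R∈ → let P , P∈ , eq = ∈-block⁻ g R∈ in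
          P , Equivalence.from InB⇔OnB P∈ , trans (sym (apply≡möbius a b c d P)) eq)
        (λ (P , P∈ , eq) → subst (_∈ˢ block g) (trans (apply≡möbius a b c d P) eq)
          (∈-block⁺ g (Equivalence.to InB⇔OnB P∈))) })
      (λ { (a , b , c , d , det≢0 , spec) → let g = gl (mat a b c d) det≢0 in g , ⊆-antisym
        (λ {R} R∈ → let P , P∈ , eq = Equivalence.to (spec R) R∈ in
          subst (_∈ˢ block g) (trans (apply≡möbius a b c d P) eq) (∈-block⁺ g (Equivalence.to InB⇔OnB P∈)))
        (λ {R} R∈ → let P , P∈ , eq = ∈-block⁻ g R∈ in
          Equivalence.from (spec R) (P , Equivalence.from InB⇔OnB P∈ , trans (sym (apply≡möbius a b c d P)) eq)) })

    ∣block∣≡k : ∀ g → ∣ block g ∣ ≡ k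
    ∣block∣≡k g = trans (∣S∣≡length unique (mk⇔ to from)) (trans (length-map image (upTo k)) (length-upTo k))
      where
      image : ℕ → X
      image i = act g (suc (β ^ i))
      unique : Unique (map image (upTo k))
      unique = unique-map-on image (Unique.upTo⁺ k) λ i∈ j∈ eq →
        β^-injective (∈-upTo⁻ i∈) (∈-upTo⁻ j∈) (Fin.suc-injective (act-injective g eq))
      to : ∀ {R} → R ∈ˢ block g → R ∈ map image (upTo k)
      to R∈ with P , P∈ , refl ← ∈-block⁻ g R∈ with i , i<k , refl ← OnB⇒β^ P∈ = ∈-map⁺ image (∈-upTo⁺ i<k)
      from : ∀ {R} → R ∈ map image (upTo k) → R ∈ˢ block g
      from R∈ with i , _ , refl ← ∈-map⁻ image {xs = upTo k} R∈ = ∈-block⁺ g {suc (β ^ i)} ([β^i]^k≡1 i)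

    toMat : (Fin (suc q′) × Fin (suc q′)) × (Fin (suc q′) × Fin (suc q′)) → Mat
    toMat ((a , b) , (c , d)) = mat a b c d

    invertible? : ∀ M → Dec (det M ≢ 0#)
    invertible? M = ¬? (det M ≟ 0#)

    matrices : List Mat
    matrices = map toMat (cartesianProduct pairs² pairs²)
      where pairs² = cartesianProduct (allFin (suc q′)) (allFin (suc q′))

    ∈-matrices : ∀ M → M ∈ matrices
    ∈-matrices (mat a b c d) = ∈-map⁺ toMat (∈-cartesianProduct⁺
      (∈-cartesianProduct⁺ (∈-allFin a) (∈-allFin b)) (∈-cartesianProduct⁺ (∈-allFin c) (∈-allFin d)))

    -- Many matrices yield the same block, through scalars and the stabiliser of B; removing
    -- duplicates makes the design simple.
    blocks : List (Subset (suc (suc q′)))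
    blocks = deduplicate _≟ˢ_ (map blockOf (filter invertible? matrices))

    blocks-unique : Unique blocks
    blocks-unique = deduplicate-! (map blockOf (filter invertible? matrices))

    ∈-blocks⁺ : ∀ g → block g ∈ blocks
    ∈-blocks⁺ (gl M det≢0) = ∈-deduplicate⁺ _≟ˢ_ (∈-map⁺ blockOf (∈-filter⁺ invertible? (∈-matrices M) det≢0))

    ∈-blocks⁻ : ∀ {S} → S ∈ blocks → ∃[ g ] (S ≡ block g)
    ∈-blocks⁻ S∈ with M , M∈ , refl ← ∈-map⁻ blockOf (∈-deduplicate⁻ _≟ˢ_ _ S∈) =
      gl M (proj₂ (∈-filter⁻ invertible? {xs = matrices} M∈)) , refl

    ∈-blocks⇔InOrbit : ∀ S → S ∈ blocks ⇔ InOrbit θ r S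
    ∈-blocks⇔InOrbit S = mk⇔
      (Equivalence.to (InOrbit⇔block S) ∘ ∈-blocks⁻)
      (λ orb → let g , S≡ = Equivalence.from (InOrbit⇔block S) orb in subst (_∈ blocks) (sym S≡) (∈-blocks⁺ g))

    blocks-size : All (λ S → ∣ S ∣ ≡ k) blocks
    blocks-size = All.tabulate λ S∈ → let g , S≡ = ∈-blocks⁻ S∈ in trans (cong ∣_∣ S≡) (∣block∣≡k g)

    -- Rotations and inversion preserve B

    rotation : ∀ {x} → x ≢ 0# → GL
    rotation {x} x≢0 = gl (mat x 0# 0# 1#) λ eq →
      x≢0 (trans (solve 1 (λ x → x := x :* con (pos 1) :- con (pos 0) :* con (pos 0)) refl x) eq)

    act-rotation : ∀ {x} (x≢0 : x ≢ 0#) z → act (rotation x≢0) (suc z) ≡ suc (x * z)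
    act-rotation {x} x≢0 z = maps⇒apply {matrix (rotation x≢0)} {suc z} {suc (x * z)} (maps 1# 1≢0
      (solve 2 (λ x z → x :* z :+ con (pos 0) :* con (pos 1) := con (pos 1) :* (x :* z)) refl x z)
      (solve 1 (λ z → con (pos 0) :* z :+ con (pos 1) :* con (pos 1) := con (pos 1) :* con (pos 1)) refl z))

    inversion : GL
    inversion = gl (mat 0# 1# 1# 0#) λ eq →
      1≢0 (trans (solve 0 (con (pos 1) := :- (con (pos 0) :* con (pos 0) :- con (pos 1) :* con (pos 1))) refl)
        (trans (cong -_ eq) -0#≈0#))

    act-inversion : ∀ {z w} → z * w ≡ 1# → act inversion (suc z) ≡ suc w
    act-inversion {z} {w} zw≡1 = maps⇒apply {matrix inversion} {suc z} {suc w} (maps z (x*y≡1⇒x≢0 zw≡1)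
      (trans (solve 1 (λ z → con (pos 0) :* z :+ con (pos 1) :* con (pos 1) := con (pos 1)) refl z) (sym zw≡1))
      (solve 1 (λ z → con (pos 1) :* z :+ con (pos 0) :* con (pos 1) := z :* con (pos 1)) refl z))

    ^k-* : ∀ {x y} → x ^ k ≡ 1# → y ^ k ≡ 1# → (x * y) ^ k ≡ 1#
    ^k-* {x} {y} x∈ y∈ = trans (^-distrib-* x y k) (trans (cong₂ _*_ x∈ y∈) (*-identityˡ 1#))

    ^k-cancel : ∀ {x y z} → x ^ k ≡ 1# → z ^ k ≡ 1# → x * y ≡ z → y ^ k ≡ 1#
    ^k-cancel {x} {y} x∈ z∈ refl = begin
      y ^ k             ≡⟨ *-identityˡ _ ⟨
      1# * y ^ k        ≡⟨ cong (_* y ^ k) x∈ ⟨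
      x ^ k * y ^ k     ≡⟨ ^-distrib-* x y k ⟨
      (x * y) ^ k       ≡⟨ z∈ ⟩
      1#                ∎

    x*[x⁻¹*z]≡z : ∀ {x} z → x ≢ 0# → x * (x ⁻¹ * z) ≡ z
    x*[x⁻¹*z]≡z {x} z x≢0 = trans (sym (*-assoc x (x ⁻¹) z)) (trans (cong (_* z) (⁻¹-inverse x x≢0)) (*-identityˡ z))

    block-rotate : ∀ h {x} (x∈ : x ^ k ≡ 1#) → block (h ∙ rotation (x^k≡1⇒x≢0 x∈)) ≡ block h
    block-rotate h {x} x∈ = block-∙ h (rotation x≢0)
      (λ { (suc z) z∈ → subst OnB (sym (act-rotation x≢0 z)) (^k-* x∈ z∈) })
      (λ { (suc z) z∈ → suc (x ⁻¹ * z) , ^k-cancel x∈ z∈ (x*[x⁻¹*z]≡z z x≢0) ,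
           trans (act-rotation x≢0 (x ⁻¹ * z)) (cong suc (x*[x⁻¹*z]≡z z x≢0)) })
      where x≢0 = x^k≡1⇒x≢0 x∈

    block-invert : ∀ h → block (h ∙ inversion) ≡ block h
    block-invert h = block-∙ h inversion
      (λ { (suc z) z∈ → subst OnB (sym (act-inversion (z*z⁻¹ z∈))) (inverse∈ z∈) })
      (λ { (suc z) z∈ → suc (z ⁻¹) , inverse∈ z∈ , act-inversion (trans (*-comm _ _) (z*z⁻¹ z∈)) })
      where
      z*z⁻¹ : ∀ {z} → z ^ k ≡ 1# → z * z ⁻¹ ≡ 1#
      z*z⁻¹ {z} z∈ = ⁻¹-inverse z (x^k≡1⇒x≢0 z∈)
      inverse∈ : ∀ {z} → z ^ k ≡ 1# → (z ⁻¹) ^ k ≡ 1#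
      inverse∈ z∈ = ^k-cancel z∈ (1^ k) (z*z⁻¹ z∈)

    β^i*β^[k∸i]≡1 : ∀ {i} → i ℕ.≤ k → β ^ i * β ^ (k ℕ.∸ i) ≡ 1#
    β^i*β^[k∸i]≡1 {i} i≤k = trans (sym (^-+ β i (k ℕ.∸ i))) (trans (cong (β ^_) (ℕ.m+[n∸m]≡n i≤k)) β^k≡1)

    β^-pairs-distinct : ∀ {i j} → 0 ℕ.< i → i ℕ.< j → j ℕ.< k → Distinct (suc 1#) (suc (β ^ i)) (suc (β ^ j))
    β^-pairs-distinct 0<i i<j j<k =
        β^-distinct 0<i (ℕ.<-trans i<j j<k) ∘ Fin.suc-injective
      , β^-distinct (ℕ.<-trans 0<i i<j) j<k ∘ Fin.suc-injective
      , β^-distinct i<j j<k ∘ Fin.suc-injective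

    -- Blocks through three given points

    module Triple {t₁ t₂ t₃ : X} (distinct : Distinct t₁ t₂ t₃) where

      Sends : GL → ℕ → ℕ → Set
      Sends g i j = act g (suc 1#) ≡ t₁ × act g (suc (β ^ i)) ≡ t₂ × act g (suc (β ^ j)) ≡ t₃

      Contains : Subset (suc (suc q′)) → Set
      Contains S = t₁ ∈ˢ S × t₂ ∈ˢ S × t₃ ∈ˢ S

      sends⇒contains : ∀ g {i j} → Sends g i j → Contains (block g)
      sends⇒contains g {i} {j} (refl , refl , refl) =
        ∈-block⁺ g {suc 1#} (1^ k) , ∈-block⁺ g {suc (β ^ i)} ([β^i]^k≡1 i) , ∈-block⁺ g {suc (β ^ j)} ([β^i]^k≡1 j)

      sends-unique : ∀ g h {i j} → 0 ℕ.< i → i ℕ.< j → j ℕ.< k → Sends g i j → Sends h i j → block g ≡ block h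
      sends-unique g h 0<i i<j j<k (g₁ , g₂ , g₃) (h₁ , h₂ , h₃) = block-cong g h
        (agree-3⇒equal g h (β^-pairs-distinct 0<i i<j j<k) (trans g₁ (sym h₁)) (trans g₂ (sym h₂)) (trans g₃ (sym h₃)))

      -- A rotation of B moves the preimage of t₁ to 1 without changing the block. If the other two
      -- exponents come in the wrong order, inversion fixes 1 and reverses them by e ↦ k - e.
      contains⇒sends : ∀ g → Contains (block g) → ∃₂ λ i j → ∃[ h ]
        (block h ≡ block g × 0 ℕ.< i × i ℕ.< j × j ℕ.< k × Sends h i j)
      contains⇒sends g (t₁∈ , t₂∈ , t₃∈)
        with suc x , x∈ , gx ← ∈-block⁻ g t₁∈
           | suc y , y∈ , gy ← ∈-block⁻ g t₂∈
           | suc z , z∈ , gz ← ∈-block⁻ g t₃∈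
        = order
        where
        x≢0 = x^k≡1⇒x≢0 x∈
        h = g ∙ rotation x≢0
        h-at : ∀ w {u t} → x * w ≡ u → act g (suc u) ≡ t → act h (suc w) ≡ t
        h-at w refl refl = trans (act-∙ g (rotation x≢0) (suc w)) (cong (act g) (act-rotation x≢0 w))
        h₁ : act h (suc 1#) ≡ t₁
        h₁ = h-at 1# (*-identityʳ x) gx
        at : ∀ {u t} → u ^ k ≡ 1# → act g (suc u) ≡ t → ∃[ i ] (i ℕ.< k × act h (suc (β ^ i)) ≡ t)
        at {u} u∈ gu = let i , i<k , eq = x^k≡1⇒x≡β^i (^k-cancel x∈ u∈ (x*[x⁻¹*z]≡z u x≢0)) in
          i , i<k , trans (cong (act h ∘ suc) (sym eq)) (h-at (x ⁻¹ * u) (x*[x⁻¹*z]≡z u x≢0) gu)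
        positive : ∀ {t i} → t₁ ≢ t → act h (suc (β ^ i)) ≡ t → 0 ℕ.< i
        positive {i = zero}  t₁≢t eq = contradiction (trans (sym h₁) eq) t₁≢t
        positive {i = suc _} _    _  = s≤s z≤n
        flipped : ∀ {t i} → i ℕ.≤ k → act h (suc (β ^ i)) ≡ t → act (h ∙ inversion) (suc (β ^ (k ℕ.∸ i))) ≡ t
        flipped {i = i} i≤k refl = trans (act-∙ h inversion (suc (β ^ (k ℕ.∸ i))))
          (cong (act h) (act-inversion (trans (*-comm _ _) (β^i*β^[k∸i]≡1 i≤k))))
        order : ∃₂ λ i j → ∃[ h ] (block h ≡ block g × 0 ℕ.< i × i ℕ.< j × j ℕ.< k × Sends h i j)
        order with at y∈ gy | at z∈ gz
        ... | i , i<k , hi | j , j<k , hj with ℕ.<-cmp i j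
        ...   | tri< i<j _ _  = i , j , h , block-rotate g x∈ , positive (proj₁ distinct) hi , i<j , j<k , h₁ , hi , hj
        ...   | tri≈ _ refl _ = contradiction (trans (sym hi) hj) (proj₂ (proj₂ distinct))
        ...   | tri> _ _ j<i  = k ℕ.∸ i , k ℕ.∸ j , h ∙ inversion
          , trans (block-invert h) (block-rotate g x∈)
          , ℕ.m<n⇒0<n∸m i<k
          , ℕ.∸-monoʳ-< j<i (ℕ.<⇒≤ i<k)
          , ℕ.∸-monoʳ-< (positive (proj₁ (proj₂ distinct)) hj) (ℕ.<⇒≤ j<k)
          , trans (act-∙ h inversion (suc 1#)) (trans (cong (act h) (act-inversion (*-identityˡ 1#))) h₁)
          , flipped (ℕ.<⇒≤ i<k) hi , flipped (ℕ.<⇒≤ j<k) hj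

      sender : ∀ {i j} → 0 ℕ.< i → i ℕ.< j → j ℕ.< k → ∃[ g ] Sends g i j
      sender 0<i i<j j<k = Transport.element T , Transport.at₁ T , Transport.at₂ T , Transport.at₃ T
        where T = transport (β^-pairs-distinct 0<i i<j j<k) distinct

      -- Such a list has exactly the blocks through the triple as members, so its length is the λ of
      -- the triple.
      ListsContaining : List (Subset (suc (suc q′))) → Set
      ListsContaining xs = Unique xs × (∀ {S} → S ∈ xs → S ∈ blocks × Contains S) × (∀ g → Contains (block g) → block g ∈ xs)

      -- The default value outside i < j < k - 1 is irrelevant.
      indexed : ℕ × ℕ → GL
      indexed (i , j) with i ℕ.<? j | j ℕ.<? k₁
      ... | yes i<j | yes j<k₁ = proj₁ (sender (s≤s z≤n) (s≤s i<j) (s≤s j<k₁))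
      ... | _       | _        = inversion

      indexed-sends : ∀ {i j} → i ℕ.< j → j ℕ.< k₁ → Sends (indexed (i , j)) (suc i) (suc j)
      indexed-sends {i} {j} i<j j<k₁ with i ℕ.<? j | j ℕ.<? k₁
      ... | yes i<j | yes j<k₁ = proj₂ (sender (s≤s z≤n) (s≤s i<j) (s≤s j<k₁))
      ... | no  i≮j | _        = contradiction i<j i≮j
      ... | yes _   | no j≮k₁  = contradiction j<k₁ j≮k₁

      quotient-at : ∀ g h {P Q t} → act g P ≡ t → act h Q ≡ t → act (inv h ∙ g) P ≡ Q
      quotient-at g h {P} {Q} gP refl = trans (act-∙ (inv h) g P) (trans (cong (act (inv h)) gP) (act-inv-act h Q))

      -- `inv h ∙ g` preserves B and fixes 1, so it keeps or inverts the other two points. Inversion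
      -- would give i′ = k - i and j′ = k - j, reversing the order of the exponents.
      sends-rigid : ¬ k₁ ∣ suc q′ → ∀ g h {i j i′ j′} →
        0 ℕ.< i → i ℕ.< j → j ℕ.< k → i′ ℕ.< j′ → j′ ℕ.< k →
        Sends g i j → Sends h i′ j′ → block g ≡ block h → i ≡ i′ × j ≡ j′
      sends-rigid k₁∤q g h {i} {j} {i′} {j′} 0<i i<j j<k i′<j′ j′<k (g₁ , g₂ , g₃) (h₁ , h₂ , h₃) eq
        with preserves-fixing-1 k₁∤q (inv h ∙ g) (block≡⇒preserves g h eq) (quotient-at g h g₁ h₁)
      ... | inj₁ linear  = β^-injective (ℕ.<-trans i<j j<k) (ℕ.<-trans i′<j′ j′<k) (linear (quotient-at g h g₂ h₂))
                         , β^-injective j<k j′<k (linear (quotient-at g h g₃ h₃))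
      ... | inj₂ inverse = contradiction i′<j′ (ℕ.<-asym
            (subst₂ ℕ._<_ (complement (ℕ.<-trans 0<i i<j) j<k j′<k (inverse (quotient-at g h g₃ h₃)))
                          (complement 0<i (ℕ.<-trans i<j j<k) (ℕ.<-trans i′<j′ j′<k) (inverse (quotient-at g h g₂ h₂)))
                          (ℕ.∸-monoʳ-< i<j (ℕ.<⇒≤ j<k))))
        where
        complement : ∀ {e e′} → 0 ℕ.< e → e ℕ.< k → e′ ℕ.< k → β ^ e * β ^ e′ ≡ 1# → k ℕ.∸ e ≡ e′
        complement {e} 0<e e<k e′<k eq = β^-injective (ℕ.∸-monoʳ-< 0<e (ℕ.<⇒≤ e<k)) e′<k
          (*-cancelˡ (x^k≡1⇒x≢0 ([β^i]^k≡1 e)) (trans (β^i*β^[k∸i]≡1 (ℕ.<⇒≤ e<k)) (sym eq)))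

      containing-generic : ¬ k₁ ∣ suc q′ → ListsContaining (map (block ∘ indexed) (pairs k₁))
      containing-generic k₁∤q = unique-map-on (block ∘ indexed) (pairs-unique k₁) injective , sound , complete
        where
        injective : ∀ {x y} → x ∈ pairs k₁ → y ∈ pairs k₁ → block (indexed x) ≡ block (indexed y) → x ≡ y
        injective {i , j} {i′ , j′} x∈ y∈ eq =
          let i<j , j<k₁ = ∈-pairs⁻ k₁ x∈
              i′<j′ , j′<k₁ = ∈-pairs⁻ k₁ y∈
              i≡i′ , j≡j′ = sends-rigid k₁∤q (indexed (i , j)) (indexed (i′ , j′))
                (s≤s z≤n) (s≤s i<j) (s≤s j<k₁) (s≤s i′<j′) (s≤s j′<k₁)
                (indexed-sends i<j j<k₁) (indexed-sends i′<j′ j′<k₁) eq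
          in cong₂ _,_ (ℕ.suc-injective i≡i′) (ℕ.suc-injective j≡j′)
        sound : ∀ {S} → S ∈ map (block ∘ indexed) (pairs k₁) → S ∈ blocks × Contains S
        sound S∈ with (i , j) , x∈ , refl ← ∈-map⁻ (block ∘ indexed) S∈ =
          let i<j , j<k₁ = ∈-pairs⁻ k₁ x∈ in
          ∈-blocks⁺ (indexed (i , j)) , sends⇒contains (indexed (i , j)) {suc i} {suc j} (indexed-sends i<j j<k₁)
        complete : ∀ g → Contains (block g) → block g ∈ map (block ∘ indexed) (pairs k₁)
        complete g T⊆ with contains⇒sends g T⊆
        ... | suc i , suc j , h , h≡g , 0<i , s≤s i<j , s≤s j<k₁ , sends =
          subst (_∈ map (block ∘ indexed) (pairs k₁))
            (trans (sends-unique (indexed (i , j)) h 0<i (s≤s i<j) (s≤s j<k₁) (indexed-sends i<j j<k₁) sends) h≡g)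
            (∈-map⁺ (block ∘ indexed) (∈-pairs⁺ i<j j<k₁))

      -- For two blocks through the triple, `inv h ∙ g` sends three points of B into B and so
      -- preserves B. Exchanging g and h gives both inclusions.
      containing-subline : ∀ {m} → k₁ ≡ p ℕ.^ m → ListsContaining (block (indexed (0 , 1)) ∷ [])
      containing-subline {m} k₁≡p^m = ([] ∷ []) , sound , complete
        where
        open Subline {m} k₁≡p^m
        -- The index (0 , 1) stands for the exponents 1 and 2: the block in which the triple comes
        -- from 1, β, β^2.
        g₀ = indexed (0 , 1)
        1<k₁ : 1 ℕ.< k₁
        1<k₁ = ℕ.<-≤-trans (s≤s (s≤s z≤n)) 3≤k₁
        sends₀ : Sends g₀ 1 2
        sends₀ = indexed-sends (s≤s z≤n) 1<k₁
        sound : ∀ {S} → S ∈ block g₀ ∷ [] → S ∈ blocks × Contains S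
        sound (here refl) = ∈-blocks⁺ g₀ , sends⇒contains g₀ {1} {2} sends₀
        preserves : ∀ g h {i j i′ j′} → 0 ℕ.< i → i ℕ.< j → j ℕ.< k → Sends g i j → Sends h i′ j′ → Preserves (inv h ∙ g)
        preserves g h {i} {j} {i′} {j′} 0<i i<j j<k (g₁ , g₂ , g₃) (h₁ , h₂ , h₃) =
          three⇒preserves (inv h ∙ g) (β^-pairs-distinct 0<i i<j j<k) (1^ k) ([β^i]^k≡1 i) ([β^i]^k≡1 j)
            (subst OnB (sym (quotient-at g h g₁ h₁)) (1^ k))
            (subst OnB (sym (quotient-at g h g₂ h₂)) ([β^i]^k≡1 i′))
            (subst OnB (sym (quotient-at g h g₃ h₃)) ([β^i]^k≡1 j′))
        complete : ∀ g → Contains (block g) → block g ∈ block g₀ ∷ []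
        complete g T⊆ with i , j , h , h≡g , 0<i , i<j , j<k , sends ← contains⇒sends g T⊆ =
          here (trans (sym h≡g) (⊆-antisym
            (block-⊆ h g₀ (preserves h g₀ {i} {j} {1} {2} 0<i i<j j<k sends sends₀))
            (block-⊆ g₀ h (preserves g₀ h {1} {2} {i} {j} (s≤s z≤n) (s≤s (s≤s z≤n)) (s≤s 1<k₁) sends₀ sends))))

      containing-list : ∃[ xs ] (ListsContaining xs × length xs ≡ lam (suc q′) k)
      -- The same decision occurs in `lam`, so the branch fixes its value.
      containing-list with k₁ ∣? suc q′
      ... | no  k₁∤q = map (block ∘ indexed) (pairs k₁) , containing-generic k₁∤q ,
            trans (length-map (block ∘ indexed) (pairs k₁)) (subst (λ e → length (pairs e) ≡ e ℕ.* (e ℕ.∸ 1) ℕ./ 2) (ℕ.suc-pred k₁ {{ℕ.>-nonZero (ℕ.<-≤-trans (s≤s z≤n) 3≤k₁)}}) (length-pairs (ℕ.pred k₁)))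
      ... | yes k₁∣q with p-part pr k₁ (ℕ.<-≤-trans (s≤s z≤n) 3≤k₁)
      ...   | m , u , k₁≡ , p∤u = (block (indexed (0 , 1)) ∷ []) , containing-subline {m} k₁≡p^m , refl
        where
        -- u divides k - 1, hence q = p^n, and is prime to p.
        u≡1 : u ≡ 1
        u≡1 = u∣p^n⇒u≡1 pr n p∤u (∣-trans (subst (u ∣_) (sym k₁≡) (n∣m*n (p ℕ.^ m))) (subst (k₁ ∣_) q≡p^n k₁∣q))
        k₁≡p^m : k₁ ≡ p ℕ.^ m
        k₁≡p^m = trans k₁≡ (trans (cong (p ℕ.^ m ℕ.*_) u≡1) (ℕ.*-identityʳ (p ℕ.^ m)))

    λ-count : ∀ T → ∣ T ∣ ≡ 3 → length (filter (T ⊆?_) blocks) ≡ lam (suc q′) k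
    -- Listing T turns its size into a pattern with three entries, and the uniqueness of the list
    -- supplies their distinctness.
    λ-count T ∣T∣≡3 with elements T in elems | elements-unique T | trans (length-elements T) ∣T∣≡3
    ... | t₁ ∷ t₂ ∷ t₃ ∷ [] | (t₁≢t₂ ∷ t₁≢t₃ ∷ []) ∷ (t₂≢t₃ ∷ []) ∷ _ | _
      with xs , (unique , sound , complete) , len ← Triple.containing-list (t₁≢t₂ , t₁≢t₃ , t₂≢t₃) =
      trans (unique-sameLength (Unique.filter⁺ (T ⊆?_) blocks-unique) unique (mk⇔ to from)) len
      where
      to : ∀ {S} → S ∈ filter (T ⊆?_) blocks → S ∈ xs
      to S∈ with S∈blocks , T⊆S ← ∈-filter⁻ (T ⊆?_) {xs = blocks} S∈
        with g , refl ← ∈-blocks⁻ S∈blocks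
        with a ∷ b ∷ c ∷ [] ← subst (All _) elems (⊆⇒All {S = T} T⊆S) = complete g (a , b , c)
      from : ∀ {S} → S ∈ xs → S ∈ filter (T ⊆?_) blocks
      from S∈ with S∈blocks , (a , b , c) ← sound S∈ =
        ∈-filter⁺ (T ⊆?_) S∈blocks (All⇒⊆ {S = T} (subst (All _) (sym elems) (a ∷ b ∷ c ∷ [])))

open import Data.Nat using (zero; _^_; _∸_; _*_; _≤_; s≤s)
open import Data.Nat.Primality using (Prime)
open import Data.Fin.Subset using (Subset; _⊆_; ∣_∣)
open import Data.Fin.Subset.Properties using (_⊆?_)
open import Data.List using (List; length; filter)
open import Data.List.Membership.Propositional using (_∈_)
open import Data.List.Relation.Unary.All using (All)
open import Data.List.Relation.Unary.Unique.Propositional using (Unique)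
open import Function.Bundles using (_⇔_)

-- A variable q with an equation, because `p ^ n` cannot be matched as a successor; the field with
-- carrier `Fin 0` is excluded by `0#`.
orbit-is-design : ∀ {p n} q → q ≡ p ^ n → Prime p → 1 ≤ n →
  (F : FiniteField q) (θ : _) → FiniteField.Primitive F θ →
  ∀ k r → 4 ≤ k → 1 ≤ r → q ∸ 1 ≡ k * r →
  Σ (List (Subset (suc q))) λ blocks →
    Unique blocks
    × (∀ S → (S ∈ blocks) ⇔ FiniteField.InOrbit F θ r S)
    × All (λ S → ∣ S ∣ ≡ k) blocks
    × (∀ T → ∣ T ∣ ≡ 3 → length (filter (T ⊆?_) blocks) ≡ lam q k)
orbit-is-design zero _ _ _ F = contradiction (FiniteField.0# F) λ ()
orbit-is-design (suc q′) q≡p^n pr 1≤n F θ generates (suc k₁) r (s≤s 3≤k₁) 1≤r q′≡kr =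
  blocks , blocks-unique , ∈-blocks⇔InOrbit , blocks-size , λ-count
  where open Orbit.Design F pr 1≤n q≡p^n θ generates 3≤k₁ 1≤r q′≡kr

theorem3 : (p n : ℕ) → Prime p → 1 ≤ n →
    (F : FiniteField (p ^ n)) → (θ : _) → FiniteField.Primitive F θ →
    (k r : ℕ) → 4 ≤ k → 1 ≤ r → p ^ n ∸ 1 ≡ k * r →
    Σ (List (Subset (suc (p ^ n)))) (λ blocks →
    Unique blocks
    × (∀ S → (S ∈ blocks) ⇔ FiniteField.InOrbit F θ r S)
    × All (λ S → ∣ S ∣ ≡ k) blocks
    × (∀ (T : Subset (suc (p ^ n))) → ∣ T ∣ ≡ 3 →
    length (filter (T ⊆?_) blocks) ≡ lam (p ^ n) k))
theorem3 p n pr 1≤n F θ generates = orbit-is-design (p ^ n) refl pr 1≤n F θ generates
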